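{- Let $G$ be a framework for a $3$-connected matroid $M$. If $G$ has a loop-edge, then $M$ is either a frame matroid or a lifted-graphic matroid.
   Context: For a graph $G$ and a vertex $v$, $\mathrm{loops}_G(v)$ denotes the set of loop-edges of $G$ at $v$. Graphs are finite and may have loops and parallel edges. For a set $X$ of edges, $G[X]$ is the subgraph of $G$ with edge-set $X$ and no isolated vertices. A graph $G$ is a framework for a matroid $M$ if (1) $E(G)=E(M)$; (2) $r_M(E(H))\le |V(H)|$ for each component $H$ of $G$; (3) for each vertex $v$ of $G$, $\mathrm{cl}_M(E(G-v))\subseteq E(G-v)\cup \mathrm{loops}_G(v)$; and (4) for each circuit $C$ of $M$, the subgraph $G[C]$ has at most two components. A framed matroid is a pair $(M,V)$ where $M$ is a matroid, $V$ is a basis of $M$, and each element of $M$ is spanned by a subset of $V$ with at most two elements; $M$ is a frame matroid if there is a framed matroid $(M',V)$ with $M=M'\setminus V$. A matroid $M$ is lifted-graphic if there is a matroid $M'$ and $e\in E(M')$ with $M'\setminus e=M$ and $M'/e$ graphic. -}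

module Defs where

open import Level using (0ℓ)
open import Data.Nat using (ℕ; zero; suc; _+_; _≤_; _<_; _⊔_)
open import Data.Fin using (Fin; zero; suc) renaming (_≟_ to _≟ᶠ_)
open import Data.Fin.Subset
  using (Subset; inside; outside; ⁅_⁆; _∈_; _∉_; _⊆_; _∪_; ∁; _-_; ∣_∣; Nonempty)
  renaming (⊥ to ∅; ⊤ to Full)
open import Data.Fin.Subset.Properties using (_⊆?_; _∈?_)
open import Data.Bool using (not; _∨_)
open import Data.List using (List; []; _∷_; map; filter; foldr) renaming (_++_ to _++ˡ_)
open import Data.Vec using (Vec; []; _∷_; tabulate; _++_)
open import Data.Product using (Σ; ∃; ∃-syntax; _×_; _,_; proj₁; proj₂)
open import Data.Sum using (_⊎_)
open import Relation.Nullary using (¬_; Dec; does)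
open import Relation.Nullary.Decidable using (_×-dec_)
open import Relation.Binary.PropositionalEquality using (_≡_)

record Matroid (n : ℕ) : Set₁ where
  field
    Indep     : Subset n → Set
    Indep?    : (X : Subset n) → Dec (Indep X)
    indep-∅   : Indep ∅
    indep-⊆   : ∀ {I J} → J ⊆ I → Indep I → Indep J
    indep-aug : ∀ {I J} → Indep I → Indep J → ∣ I ∣ < ∣ J ∣ →
                ∃[ x ] (x ∈ J × x ∉ I × Indep (I ∪ ⁅ x ⁆))

open Matroid public

allSubsets : (n : ℕ) → List (Subset n)
allSubsets zero    = [] ∷ []
allSubsets (suc n) = map (outside ∷_) (allSubsets n) ++ˡ map (inside ∷_) (allSubsets n)

rank : ∀ {n} → Matroid n → Subset n → ℕ
rank {n} M X =
  foldr _⊔_ 0 (map ∣_∣ (filter (λ I → (I ⊆? X) ×-dec Indep? M I) (allSubsets n)))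

InCl : ∀ {n} → Matroid n → Subset n → Fin n → Set
InCl M X e = rank M (X ∪ ⁅ e ⁆) ≡ rank M X

Circuit : ∀ {n} → Matroid n → Subset n → Set
Circuit M C = ¬ Indep M C × (∀ e → e ∈ C → Indep M (C - e))

IsBasis : ∀ {n} → Matroid n → Subset n → Set
IsBasis M B = Indep M B × (∀ e → e ∉ B → ¬ Indep M (B ∪ ⁅ e ⁆))

-- 3-connected (Tutte): no j-separation for j < 3, where a j-separation is a
-- partition (X, E-X) with |X|,|E-X| ≥ j and r(X) + r(E-X) - r(M) < j.
ThreeConnected : ∀ {n} → Matroid n → Set
ThreeConnected M = ∀ j → 1 ≤ j → j < 3 → ∀ X → j ≤ ∣ X ∣ → j ≤ ∣ ∁ X ∣ →
  rank M Full + j ≤ rank M X + rank M (∁ X)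

-- Graphs: m vertices (Fin m), edges Fin n, each edge with its two ends
-- (loops: both ends equal; parallel edges allowed).

Ends : ℕ → ℕ → Set
Ends n m = Fin n → Fin m × Fin m

module _ {n m : ℕ} (ends : Ends n m) where

  Joins : Fin n → Fin m → Fin m → Set
  Joins e u w = (proj₁ (ends e) ≡ u × proj₂ (ends e) ≡ w) ⊎
                (proj₁ (ends e) ≡ w × proj₂ (ends e) ≡ u)

  data Conn (X : Subset n) : Fin m → Fin m → Set where
    here : ∀ {u} → Conn X u u
    step : ∀ {u w v} e → e ∈ X → Joins e u w → Conn X w v → Conn X u v

  Incident : Fin n → Fin m → Set
  Incident e v = proj₁ (ends e) ≡ v ⊎ proj₂ (ends e) ≡ v

  IsLoopAt : Fin m → Fin n → Set
  IsLoopAt v e = proj₁ (ends e) ≡ v × proj₂ (ends e) ≡ v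

  HasLoop : Set
  HasLoop = ∃[ e ] (proj₁ (ends e) ≡ proj₂ (ends e))

  IsComponent : Subset m → Set
  IsComponent S = Nonempty S
                × (∀ e u w → u ∈ S → Joins e u w → w ∈ S)
                × (∀ u v → u ∈ S → v ∈ S → Conn Full u v)

  edgesOf : Subset m → Subset n
  edgesOf S = tabulate (λ e → does (proj₁ (ends e) ∈? S))

  edgesAvoiding : Fin m → Subset n
  edgesAvoiding v =
    tabulate (λ e → not (does (proj₁ (ends e) ≟ᶠ v) ∨ does (proj₂ (ends e) ≟ᶠ v)))

  -- u is a vertex of G[X] (G[X] has no isolated vertices)
  VertexOf : Subset n → Fin m → Set
  VertexOf X u = ∃[ e ] (e ∈ X × Incident e u)

  AtMostTwoComponents : Subset n → Set
  AtMostTwoComponents X = ∀ u₁ u₂ u₃ → VertexOf X u₁ → VertexOf X u₂ → VertexOf X u₃ →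
    Conn X u₁ u₂ ⊎ Conn X u₁ u₃ ⊎ Conn X u₂ u₃

  -- X is the edge set of a forest (every edge is a non-loop bridge of G[X])
  Forest : Subset n → Set
  Forest X = ∀ e → e ∈ X → ¬ Conn (X - e) (proj₁ (ends e)) (proj₂ (ends e))

-- Frameworks (condition (1), E(G) = E(M), holds by construction)

record IsFramework {n m : ℕ} (M : Matroid n) (ends : Ends n m) : Set where
  field
    cond2 : ∀ S → IsComponent ends S → rank M (edgesOf ends S) ≤ ∣ S ∣
    cond3 : ∀ v e → InCl M (edgesAvoiding ends v) e →
            e ∈ edgesAvoiding ends v ⊎ IsLoopAt ends v e
    cond4 : ∀ C → Circuit M C → AtMostTwoComponents ends C

IsGraphicIndep : ∀ {n} → (Subset n → Set) → Set
IsGraphicIndep {n} Ind =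
  ∃[ m ] Σ (Ends n m) λ ends → ∀ X → (Ind X → Forest ends X) × (Forest ends X → Ind X)

-- M = M' \ V for a framed matroid (M', V); E(M') = V ⊔ E(M), V = first k elements
IsFrame : ∀ {n} → Matroid n → Set₁
IsFrame {n} M = ∃[ k ] Σ (Matroid (k + n)) λ M' →
    IsBasis M' (Full {k} ++ ∅ {n})
  × (∀ x → ∃[ S ] (∣ S ∣ ≤ 2 × InCl M' (S ++ ∅ {n}) x))
  × (∀ X → (Indep M X → Indep M' (∅ {k} ++ X)) × (Indep M' (∅ {k} ++ X) → Indep M X))

-- M = M' \ e and M' / e graphic; E(M') = {e} ⊔ E(M), e = zero.
-- Independent sets of M'/e: I with r(I ∪ e) = |I| + r({e}).
IsLiftedGraphic : ∀ {n} → Matroid n → Set₁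
IsLiftedGraphic {n} M = Σ (Matroid (suc n)) λ M' →
    (∀ X → (Indep M X → Indep M' (outside ∷ X)) × (Indep M' (outside ∷ X) → Indep M X))
  × IsGraphicIndep (λ X → rank M' (inside ∷ X) ≡ ∣ X ∣ + rank M' ⁅ zero ⁆)

{-# OPTIONS --safe #-}
module Submission where

-- Growing a vertex set S along an edge to a new vertex w raises the rank by one, by
-- condition (3) at w; with condition (2) this gives r(E[S]) ≤ |S| for every S.
-- Let e be a loop-edge at v and suppose that all edges lie in the component of v.
--
-- * If e ∉ cl(E(G - v)), then vertex-disjoint parts are skew in M: a circuit with two
--   components C₁, C₂ would, after growing v to a set containing one of them and avoiding
--   the other, contradict the rank bound. Skewness makes the following a matroid M′, which
--   shows that M is a frame matroid: T ∪ X, with T a set of joints and X ⊆ E, is independent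
--   iff X is independent in M and |X ∩ E[S]| + |T ∩ S| ≤ |S| for all S.
-- * If e ∈ cl(E(G - v)), then growing S inside G - v gives r(E[S] ∪ e) ≤ |S| for all
--   nonempty S, since otherwise M has a 2-separation. So G represents M / e up to the loop
--   e, and M is lifted-graphic through an element parallel to e.
--
-- If some edge lies outside the component of v, then 3-connectivity yields a loop-edge that
-- is alone in its component, and the bound of the second case holds for that loop-edge.

open import Defs
open import Data.Empty using (⊥; ⊥-elim)
open import Data.Fin using (Fin; zero; suc; _↑ˡ_; _↑ʳ_; splitAt) renaming (_≟_ to _≟ᶠ_)
import Data.Fin.Properties as Fin
open import Data.Fin.Subset
  using (Subset; inside; outside; ⁅_⁆; _∈_; _∉_; _⊆_; _∪_; _∩_; _─_; ∁; _-_; ∣_∣; Nonempty)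
  renaming (⊥ to ∅; ⊤ to Full)
open import Data.Fin.Subset.Properties
open import Data.List using (List; []; _∷_; map; filter; foldr)
open import Data.List.Membership.Propositional using () renaming (_∈_ to _∈ˡ_)
open import Data.List.Membership.Propositional.Properties
  using (∈-map⁺; ∈-++⁺ˡ; ∈-++⁺ʳ; ∈-filter⁺; ∈-filter⁻)
open import Data.List.Relation.Unary.Any using (here; there)
open import Data.Nat using (ℕ; zero; suc; _+_; _∸_; _≤_; _<_; _⊔_; z≤n; s≤s; _≤?_; _<?_)
open import Data.Nat.Properties
open import Data.Nat.Tactic.RingSolver using (solve-∀)
open import Data.Product using (∃-syntax; _×_; _,_; proj₁; proj₂)
open import Data.Sum using (_⊎_; inj₁; inj₂; [_,_]′)
open import Data.Vec using ([]; _∷_; here; there; tabulate; _++_; take; drop)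
open import Data.Vec.Properties using (lookup∘tabulate; []=⇒lookup; lookup⇒[]=)
open import Function using (_∘_; id)
open import Relation.Nullary using (¬_; Dec; yes; no; does)
open import Relation.Nullary.Decidable using (_×-dec_; _⊎-dec_; ¬?; dec-true; decidable-stable)
open import Relation.Unary using (Decidable)
open import Relation.Binary.PropositionalEquality
  using (_≡_; _≢_; refl; sym; trans; cong; cong₂; subst)

-- Finite subsets: insertion, selection and cardinality.

private variable
  n : ℕ

∈-insert⁻ : ∀ (p : Subset n) {x y} → y ∈ p ∪ ⁅ x ⁆ → y ∈ p ⊎ y ≡ x
∈-insert⁻ p {x} y∈ with x∈p∪q⁻ p ⁅ x ⁆ y∈
... | inj₁ y∈p = inj₁ y∈p
... | inj₂ y∈x = inj₂ (x∈⁅y⁆⇒x≡y x y∈x)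

∈-insertˡ : ∀ {p : Subset n} {x y} → y ∈ p → y ∈ p ∪ ⁅ x ⁆
∈-insertˡ y∈p = x∈p∪q⁺ (inj₁ y∈p)

∈-insertʳ : ∀ (p : Subset n) x → x ∈ p ∪ ⁅ x ⁆
∈-insertʳ p x = x∈p∪q⁺ {p = p} (inj₂ (x∈⁅x⁆ x))

insert-⊆ : ∀ {p q : Subset n} {x} → p ⊆ q → x ∈ q → p ∪ ⁅ x ⁆ ⊆ q
insert-⊆ {p = p} p⊆q x∈q y∈ with ∈-insert⁻ p y∈
... | inj₁ y∈p  = p⊆q y∈p
... | inj₂ refl = x∈q

insert-mono : ∀ {p q : Subset n} {x} → p ⊆ q → p ∪ ⁅ x ⁆ ⊆ q ∪ ⁅ x ⁆
insert-mono {q = q} {x} p⊆q = insert-⊆ (∈-insertˡ ∘ p⊆q) (∈-insertʳ q x)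

∪-⊆ : ∀ {p q r : Subset n} → p ⊆ r → q ⊆ r → p ∪ q ⊆ r
∪-⊆ {p = p} {q} p⊆r q⊆r x∈ = [ p⊆r , q⊆r ]′ (x∈p∪q⁻ p q x∈)

⁅⁆-⊆ : ∀ {p : Subset n} {x} → x ∈ p → ⁅ x ⁆ ⊆ p
⁅⁆-⊆ {x = x} x∈p y∈ rewrite x∈⁅y⁆⇒x≡y x y∈ = x∈p

∈-─⁻ : ∀ (p q : Subset n) {x} → x ∈ p ─ q → x ∈ p × x ∉ q
∈-─⁻ p q x∈ = p─q⊆p p q x∈ , go p q x∈
  where
  go : ∀ {n} (p q : Subset n) {x} → x ∈ p ─ q → x ∉ q
  go (inside ∷ p) (inside ∷ q) () here
  go (outside ∷ p) (inside ∷ q) () here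
  go (_ ∷ p) (_ ∷ q) (there x∈) (there x∈q) = go p q x∈ x∈q

select : {P : Fin n → Set} → Decidable P → Subset n
select P? = tabulate (λ x → does (P? x))

∈-select⁺ : {P : Fin n → Set} (P? : Decidable P) {x : Fin n} → P x → x ∈ select P?
∈-select⁺ P? {x} px =
  lookup⇒[]= x _ (trans (lookup∘tabulate (λ y → does (P? y)) x) (dec-true (P? x) px))

∈-select⁻ : {P : Fin n → Set} (P? : Decidable P) {x : Fin n} → x ∈ select P? → P x
∈-select⁻ P? {x} x∈ with P? x
  | trans (sym (lookup∘tabulate (λ y → does (P? y)) x)) ([]=⇒lookup x∈)
... | yes px | _ = px

∣∪∣+∣∩∣ : ∀ (p q : Subset n) → ∣ p ∪ q ∣ + ∣ p ∩ q ∣ ≡ ∣ p ∣ + ∣ q ∣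
∣∪∣+∣∩∣ []            []            = refl
∣∪∣+∣∩∣ (outside ∷ p) (outside ∷ q) = ∣∪∣+∣∩∣ p q
∣∪∣+∣∩∣ (inside ∷ p)  (outside ∷ q) = cong suc (∣∪∣+∣∩∣ p q)
∣∪∣+∣∩∣ (outside ∷ p) (inside ∷ q)  =
  trans (cong suc (∣∪∣+∣∩∣ p q)) (sym (+-suc ∣ p ∣ ∣ q ∣))
∣∪∣+∣∩∣ (inside ∷ p)  (inside ∷ q)  = cong suc
  (trans (+-suc _ _) (trans (cong suc (∣∪∣+∣∩∣ p q)) (sym (+-suc ∣ p ∣ ∣ q ∣))))

cover-card : ∀ {r p q : Subset n} → (∀ {x} → x ∈ r → x ∈ p ⊎ x ∈ q) → ∣ r ∣ ≤ ∣ p ∣ + ∣ q ∣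
cover-card {r = r} {p} {q} r⊆ = begin
  ∣ r ∣                     ≤⟨ p⊆q⇒∣p∣≤∣q∣ (λ x∈ → x∈p∪q⁺ (r⊆ x∈)) ⟩
  ∣ p ∪ q ∣                 ≤⟨ m≤m+n _ _ ⟩
  ∣ p ∪ q ∣ + ∣ p ∩ q ∣     ≡⟨ ∣∪∣+∣∩∣ p q ⟩
  ∣ p ∣ + ∣ q ∣             ∎
  where open ≤-Reasoning

∅-card : ∀ {p : Subset n} → (∀ {x} → x ∉ p) → ∣ p ∣ ≡ 0
∅-card {n} {p} x∉ = trans (cong ∣_∣ (Empty-unique (λ (x , x∈) → x∉ x∈))) (∣⊥∣≡0 n)

disjoint-card : ∀ {r p q : Subset n} → p ⊆ r → q ⊆ r → (∀ {x} → x ∈ p → x ∉ q) →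
                ∣ p ∣ + ∣ q ∣ ≤ ∣ r ∣
disjoint-card {r = r} {p} {q} p⊆r q⊆r disj = begin
  ∣ p ∣ + ∣ q ∣             ≡⟨ ∣∪∣+∣∩∣ p q ⟨
  ∣ p ∪ q ∣ + ∣ p ∩ q ∣
    ≡⟨ cong (∣ p ∪ q ∣ +_) (∅-card (λ x∈ → let (a , b) = x∈p∩q⁻ p q x∈ in disj a b)) ⟩
  ∣ p ∪ q ∣ + 0             ≡⟨ +-identityʳ _ ⟩
  ∣ p ∪ q ∣                 ≤⟨ p⊆q⇒∣p∣≤∣q∣ (∪-⊆ p⊆r q⊆r) ⟩
  ∣ r ∣                     ∎
  where open ≤-Reasoning

insert-card : ∀ (p : Subset n) {x} → x ∉ p → ∣ p ∪ ⁅ x ⁆ ∣ ≡ suc ∣ p ∣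
insert-card p {x} x∉p = ≤-antisym
  (subst (∣ p ∪ ⁅ x ⁆ ∣ ≤_) +1 (cover-card (x∈p∪q⁻ p ⁅ x ⁆)))
  (subst (_≤ ∣ p ∪ ⁅ x ⁆ ∣) +1
    (disjoint-card (p⊆p∪q ⁅ x ⁆) (q⊆p∪q p ⁅ x ⁆) (λ y∈p y∈x → x∉p (subst (_∈ p) (x∈⁅y⁆⇒x≡y x y∈x) y∈p))))
  where
  +1 : ∣ p ∣ + ∣ ⁅ x ⁆ ∣ ≡ suc ∣ p ∣
  +1 = trans (cong (∣ p ∣ +_) (∣⁅x⁆∣≡1 x)) (+-comm _ 1)

insert-card-≤ : ∀ (p : Subset n) x → ∣ p ∪ ⁅ x ⁆ ∣ ≤ suc ∣ p ∣
insert-card-≤ p x = ≤-trans (cover-card (x∈p∪q⁻ p ⁅ x ⁆))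
  (≤-reflexive (trans (cong (∣ p ∣ +_) (∣⁅x⁆∣≡1 x)) (+-comm _ 1)))

remove-card : ∀ {p : Subset n} {x} → x ∈ p → ∣ p ∣ ≡ suc ∣ p - x ∣
remove-card {p = p} {x} x∈p = ≤-antisym
  (≤-trans (p⊆q⇒∣p∣≤∣q∣ p⊆) (insert-card-≤ (p - x) x)) (x∈p⇒∣p-x∣<∣p∣ x∈p)
  where
  p⊆ : p ⊆ (p - x) ∪ ⁅ x ⁆
  p⊆ {y} y∈p with y ≟ᶠ x
  ... | yes refl = ∈-insertʳ (p - x) x
  ... | no y≢x   = ∈-insertˡ (x∈p∧x≢y⇒x∈p-y y∈p y≢x)

nonempty-card : ∀ {p : Subset n} {x} → x ∈ p → 1 ≤ ∣ p ∣
nonempty-card {x = x} x∈p = subst (_≤ _) (∣⁅x⁆∣≡1 x) (p⊆q⇒∣p∣≤∣q∣ (⁅⁆-⊆ x∈p))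

two-card : ∀ {p : Subset n} {x y} → x ∈ p → y ∈ p → x ≢ y → 2 ≤ ∣ p ∣
two-card {p = p} {x} {y} x∈p y∈p x≢y =
  subst (_≤ ∣ p ∣) (cong₂ _+_ (∣⁅x⁆∣≡1 x) (∣⁅x⁆∣≡1 y))
    (disjoint-card (⁅⁆-⊆ x∈p) (⁅⁆-⊆ y∈p)
      (λ z∈x z∈y → x≢y (trans (sym (x∈⁅y⁆⇒x≡y x z∈x)) (x∈⁅y⁆⇒x≡y y z∈y))))

pigeonhole : ∀ {p q : Subset n} → ∣ p ∣ < ∣ q ∣ → ∃[ x ] (x ∈ q × x ∉ p)
pigeonhole {p = p} {q} p<q with nonempty? (q ─ p)
... | yes (x , x∈) = x , ∈-─⁻ q p x∈
... | no empty = ⊥-elim (<⇒≱ p<q (p⊆q⇒∣p∣≤∣q∣ q⊆p))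
  where
  q⊆p : q ⊆ p
  q⊆p {x} x∈q with x ∈? p
  ... | yes x∈p = x∈p
  ... | no x∉p  = ⊥-elim (empty (x , x∈p∧x∉q⇒x∈p─q x∈q x∉p))

-- The rank function of a matroid.

∈-allSubsets : ∀ (p : Subset n) → p ∈ˡ allSubsets n
∈-allSubsets []            = here refl
∈-allSubsets (outside ∷ p) = ∈-++⁺ˡ (∈-map⁺ (outside ∷_) (∈-allSubsets p))
∈-allSubsets (inside ∷ p)  = ∈-++⁺ʳ _ (∈-map⁺ (inside ∷_) (∈-allSubsets p))

card-max : List (Subset n) → ℕ
card-max ps = foldr _⊔_ 0 (map ∣_∣ ps)

∈⇒≤card-max : ∀ {p : Subset n} {ps} → p ∈ˡ ps → ∣ p ∣ ≤ card-max ps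
∈⇒≤card-max (here refl) = m≤m⊔n _ _
∈⇒≤card-max {ps = q ∷ _} (there p∈) = ≤-trans (∈⇒≤card-max p∈) (m≤n⊔m ∣ q ∣ _)

card-max-attained : ∀ (ps : List (Subset n)) →
  card-max ps ≡ 0 ⊎ ∃[ p ] (p ∈ˡ ps × ∣ p ∣ ≡ card-max ps)
card-max-attained [] = inj₁ refl
card-max-attained (p ∷ ps) with ⊔-sel ∣ p ∣ (card-max ps) | card-max-attained ps
... | inj₁ eq | _ = inj₂ (p , here refl , sym eq)
... | inj₂ eq | inj₁ z = inj₁ (trans eq z)
... | inj₂ eq | inj₂ (q , q∈ , e) = inj₂ (q , there q∈ , trans e (sym eq))

module Rank (M : Matroid n) where

  r : Subset n → ℕ
  r = rank M

  indep⇒≤rank : ∀ {I X} → I ⊆ X → Indep M I → ∣ I ∣ ≤ r X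
  indep⇒≤rank {I} {X} I⊆X indI =
    ∈⇒≤card-max (∈-filter⁺ (λ J → (J ⊆? X) ×-dec Indep? M J) (∈-allSubsets I) (I⊆X , indI))

  basis : ∀ X → ∃[ I ] (I ⊆ X × Indep M I × ∣ I ∣ ≡ r X)
  basis X with card-max-attained (filter (λ J → (J ⊆? X) ×-dec Indep? M J) (allSubsets n))
  -- A maximum equal to the starting value 0 of the fold is attained by the empty set.
  ... | inj₁ r≡0 = ∅ , ⊥⊆ , indep-∅ M , trans (∣⊥∣≡0 n) (sym r≡0)
  ... | inj₂ (I , I∈ , eq) with ∈-filter⁻ (λ J → (J ⊆? X) ×-dec Indep? M J) {xs = allSubsets n} I∈
  ...   | _ , I⊆X , indI = I , I⊆X , indI , eq

  rank-≤ : ∀ {X c} → (∀ {I} → I ⊆ X → Indep M I → ∣ I ∣ ≤ c) → r X ≤ c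
  rank-≤ {X} bound with basis X
  ... | I , I⊆X , indI , eq = subst (_≤ _) eq (bound I⊆X indI)

  rank-mono : ∀ {X Y} → X ⊆ Y → r X ≤ r Y
  rank-mono X⊆Y = rank-≤ (λ I⊆X → indep⇒≤rank (X⊆Y ∘ I⊆X))

  rank≤card : ∀ X → r X ≤ ∣ X ∣
  rank≤card X = rank-≤ (λ I⊆X _ → p⊆q⇒∣p∣≤∣q∣ I⊆X)

  indep⇒rank : ∀ {X} → Indep M X → r X ≡ ∣ X ∣
  indep⇒rank {X} indX = ≤-antisym (rank≤card X) (indep⇒≤rank ⊆-refl indX)

  -- Turns a rank count into independence: a basis of `X` that has as many elements as `X` is all of
  -- `X`.
  rank⇒indep : ∀ {X} → ∣ X ∣ ≤ r X → Indep M X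
  rank⇒indep {X} X≤r with basis X
  ... | I , I⊆X , indI , eq = indep-⊆ M X⊆I indI
    where
    X⊆I : X ⊆ I
    X⊆I {x} x∈X with x ∈? I
    ... | yes x∈I = x∈I
    ... | no x∉I  = ⊥-elim (<⇒≱ (p⊂q⇒∣p∣<∣q∣ (I⊆X , x , x∈X , x∉I)) (subst (∣ X ∣ ≤_) (sym eq) X≤r))

  -- Elements taken from a basis of `X` augment `I` until it has `r X` elements; `d` counts those
  -- still missing.
  extend-basis : ∀ {I X} → I ⊆ X → Indep M I →
                 ∃[ J ] (I ⊆ J × J ⊆ X × Indep M J × ∣ J ∣ ≡ r X)
  extend-basis {I} {X} I⊆X indI = go (r X ∸ ∣ I ∣) I⊆X indI (m∸n+n≡m (indep⇒≤rank I⊆X indI))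
    where
    B = proj₁ (basis X)
    go : ∀ d {I} → I ⊆ X → Indep M I → d + ∣ I ∣ ≡ r X →
         ∃[ J ] (I ⊆ J × J ⊆ X × Indep M J × ∣ J ∣ ≡ r X)
    go zero {I} I⊆X indI eq = I , ⊆-refl , I⊆X , indI , eq
    go (suc d) {I} I⊆X indI eq with basis X
    ... | B , B⊆X , indB , eqB
      with indep-aug M indI indB (subst (∣ I ∣ <_) (trans eq (sym eqB)) (s≤s (m≤n+m ∣ I ∣ d)))
    ... | x , x∈B , x∉I , ind
      with go d (insert-⊆ I⊆X (B⊆X x∈B)) ind
             (trans (cong (d +_) (insert-card I x∉I)) (trans (+-suc d ∣ I ∣) eq))
    ... | J , I+x⊆J , rest = J , I+x⊆J ∘ ∈-insertˡ , rest

  -- Stated for any `U` below the intersection and any `W` below the union, which avoids rewriting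
  -- sets in the applications. A basis of `U` extends to a basis `J` of `X ∪ Y`; the traces of `J`
  -- on `X` and `Y` are independent and share the basis of `U`.
  submodular : ∀ {X Y U W} → U ⊆ X → U ⊆ Y → (∀ {x} → x ∈ W → x ∈ X ⊎ x ∈ Y) →
               r W + r U ≤ r X + r Y
  submodular {X} {Y} {U} {W} U⊆X U⊆Y W⊆ with basis U
  ... | I , I⊆U , indI , eqI
    with extend-basis {I} {X ∪ Y} (λ x∈ → x∈p∪q⁺ (inj₁ (U⊆X (I⊆U x∈)))) indI
  ... | J , I⊆J , J⊆ , indJ , eqJ = begin
    r W + r U             ≤⟨ +-monoˡ-≤ (r U) (rank-mono (λ x∈ → x∈p∪q⁺ (W⊆ x∈))) ⟩
    r (X ∪ Y) + r U       ≡⟨ cong₂ _+_ eqJ eqI ⟨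
    ∣ J ∣ + ∣ I ∣
      ≤⟨ +-mono-≤ (p⊆q⇒∣p∣≤∣q∣ J⊆∪) (p⊆q⇒∣p∣≤∣q∣ I⊆∩) ⟩
    ∣ (J ∩ X) ∪ (J ∩ Y) ∣ + ∣ (J ∩ X) ∩ (J ∩ Y) ∣
      ≡⟨ ∣∪∣+∣∩∣ (J ∩ X) (J ∩ Y) ⟩
    ∣ J ∩ X ∣ + ∣ J ∩ Y ∣
      ≤⟨ +-mono-≤ (indep⇒≤rank (p∩q⊆q J X) (indep-⊆ M (p∩q⊆p J X) indJ))
                  (indep⇒≤rank (p∩q⊆q J Y) (indep-⊆ M (p∩q⊆p J Y) indJ)) ⟩
    r X + r Y             ∎
    where
    open ≤-Reasoning
    J⊆∪ : J ⊆ (J ∩ X) ∪ (J ∩ Y)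
    J⊆∪ x∈ with x∈p∪q⁻ X Y (J⊆ x∈)
    ... | inj₁ x∈X = x∈p∪q⁺ (inj₁ (x∈p∩q⁺ (x∈ , x∈X)))
    ... | inj₂ x∈Y = x∈p∪q⁺ {p = J ∩ X} (inj₂ (x∈p∩q⁺ (x∈ , x∈Y)))
    I⊆∩ : I ⊆ (J ∩ X) ∩ (J ∩ Y)
    I⊆∩ x∈ = x∈p∩q⁺ (x∈p∩q⁺ (I⊆J x∈ , U⊆X (I⊆U x∈)) , x∈p∩q⁺ (I⊆J x∈ , U⊆Y (I⊆U x∈)))

  subadditive : ∀ {X Y W} → (∀ {x} → x ∈ W → x ∈ X ⊎ x ∈ Y) → r W ≤ r X + r Y
  subadditive {W = W} W⊆ = ≤-trans (m≤m+n (r W) (r ∅)) (submodular ⊥⊆ ⊥⊆ W⊆)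

  rank-⁅⁆≤1 : ∀ x → r ⁅ x ⁆ ≤ 1
  rank-⁅⁆≤1 x = subst (r ⁅ x ⁆ ≤_) (∣⁅x⁆∣≡1 x) (rank≤card ⁅ x ⁆)

  -- The rank increase over `Y` passes down to `X` by submodularity for `X ∪ ⁅ x ⁆` and `Y`, which
  -- share `X`.
  rank-insert : ∀ {X Y x} → X ⊆ Y → ¬ InCl M Y x → suc (r X) ≤ r (X ∪ ⁅ x ⁆)
  rank-insert {X} {Y} {x} X⊆Y x∉cl = +-cancelʳ-≤ (r Y) _ _ (begin
    suc (r X) + r Y              ≡⟨ cong suc (+-comm (r X) (r Y)) ⟩
    suc (r Y) + r X              ≤⟨ +-monoˡ-≤ (r X) (≤∧≢⇒< (rank-mono (p⊆p∪q ⁅ x ⁆)) (x∉cl ∘ sym)) ⟩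
    r (Y ∪ ⁅ x ⁆) + r X          ≤⟨ submodular (p⊆p∪q ⁅ x ⁆) X⊆Y split ⟩
    r (X ∪ ⁅ x ⁆) + r Y          ∎)
    where
    open ≤-Reasoning
    split : ∀ {y} → y ∈ Y ∪ ⁅ x ⁆ → y ∈ X ∪ ⁅ x ⁆ ⊎ y ∈ Y
    split y∈ with ∈-insert⁻ Y y∈
    ... | inj₁ y∈Y  = inj₂ y∈Y
    ... | inj₂ refl = inj₁ (∈-insertʳ X x)

  InCl-mono : ∀ {X Y x} → X ⊆ Y → InCl M X x → InCl M Y x
  InCl-mono {X} {Y} {x} X⊆Y x∈cl = decidable-stable (_ ≟ _)
    (λ x∉cl → <-irrefl (sym x∈cl) (rank-insert X⊆Y x∉cl))

  -- Deleting elements as long as the set stays dependent ends at a circuit; `d` bounds the number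
  -- of deletions.
  circuit-in : ∀ {D} → ¬ Indep M D → ∃[ C ] (C ⊆ D × Circuit M C)
  circuit-in {D} = go ∣ D ∣ ≤-refl
    where
    any-dep? : ∀ D → Dec (∃[ e ] (e ∈ D × ¬ Indep M (D - e)))
    any-dep? D = Fin.any? (λ e → (e ∈? D) ×-dec ¬? (Indep? M (D - e)))
    go : ∀ d {D} → ∣ D ∣ ≤ d → ¬ Indep M D → ∃[ C ] (C ⊆ D × Circuit M C)
    go d {D} D≤d dep with any-dep? D
    go d {D} D≤d dep | no all = D , ⊆-refl , dep ,
      λ e e∈D → decidable-stable (Indep? M (D - e)) (λ d → all (e , e∈D , d))
    go zero {D} D≤d dep | yes (e , e∈D , _) = ⊥-elim (<⇒≱ (nonempty-card e∈D) D≤d)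
    go (suc d) {D} D≤d dep | yes (e , e∈D , dep′)
      with go d (≤-pred (≤-trans (x∈p⇒∣p-x∣<∣p∣ e∈D) D≤d)) dep′
    ... | C , C⊆ , circ = C , p─q⊆p D ⁅ e ⁆ ∘ C⊆ , circ

-- Graphs: induced edge sets, connectivity and growing vertex sets.

module Graph {n m : ℕ} (ends : Ends n m) where

  src tgt : Fin n → Fin m
  src e = proj₁ (ends e)
  tgt e = proj₂ (ends e)

  within? : ∀ S → Decidable (λ e → src e ∈ S × tgt e ∈ S)
  within? S e = (src e ∈? S) ×-dec (tgt e ∈? S)

  within : Subset m → Subset n
  within S = select (within? S)

  ∈-within⁺ : ∀ S {e} → src e ∈ S → tgt e ∈ S → e ∈ within S
  ∈-within⁺ S s t = ∈-select⁺ (within? S) (s , t)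

  ∈-within⁻ : ∀ S {e} → e ∈ within S → src e ∈ S × tgt e ∈ S
  ∈-within⁻ S = ∈-select⁻ (within? S)

  within-mono : ∀ {S T} → S ⊆ T → within S ⊆ within T
  within-mono {S} {T} S⊆T e∈ = let (s , t) = ∈-within⁻ S e∈ in ∈-within⁺ T (S⊆T s) (S⊆T t)

  joins-sym : ∀ {e u w} → Joins ends e u w → Joins ends e w u
  joins-sym (inj₁ (p , q)) = inj₂ (p , q)
  joins-sym (inj₂ (p , q)) = inj₁ (p , q)

  joins-ends : ∀ e → Joins ends e (src e) (tgt e)
  joins-ends e = inj₁ (refl , refl)

  joins-within⁺ : ∀ S {e u w} → Joins ends e u w → u ∈ S → w ∈ S → e ∈ within S
  joins-within⁺ S (inj₁ (refl , refl)) u∈ w∈ = ∈-within⁺ S u∈ w∈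
  joins-within⁺ S (inj₂ (refl , refl)) u∈ w∈ = ∈-within⁺ S w∈ u∈

  joins-within⁻ : ∀ S {e u w} → Joins ends e u w → e ∈ within S → u ∈ S × w ∈ S
  joins-within⁻ S (inj₁ (refl , refl)) e∈ = ∈-within⁻ S e∈
  joins-within⁻ S (inj₂ (refl , refl)) e∈ = let (s , t) = ∈-within⁻ S e∈ in t , s

  joins-incident : ∀ {e u w} → Joins ends e u w → Incident ends e u
  joins-incident (inj₁ (p , _)) = inj₁ p
  joins-incident (inj₂ (_ , q)) = inj₂ q

  incident-joins : ∀ {e u w x} → Joins ends e u w → Incident ends e x → x ≡ u ⊎ x ≡ w
  incident-joins (inj₁ (refl , refl)) (inj₁ refl) = inj₁ refl
  incident-joins (inj₁ (refl , refl)) (inj₂ refl) = inj₂ refl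
  incident-joins (inj₂ (refl , refl)) (inj₁ refl) = inj₂ refl
  incident-joins (inj₂ (refl , refl)) (inj₂ refl) = inj₁ refl

  within-incident : ∀ S {e u} → e ∈ within S → Incident ends e u → u ∈ S
  within-incident S e∈ (inj₁ refl) = proj₁ (∈-within⁻ S e∈)
  within-incident S e∈ (inj₂ refl) = proj₂ (∈-within⁻ S e∈)

  incident? : ∀ e u → Dec (Incident ends e u)
  incident? e u = (src e ≟ᶠ u) ⊎-dec (tgt e ≟ᶠ u)

  ∈-avoiding⁺ : ∀ v {e} → ¬ Incident ends e v → e ∈ edgesAvoiding ends v
  ∈-avoiding⁺ v = ∈-select⁺ (λ e → ¬? (incident? e v))

  ∈-avoiding⁻ : ∀ v {e} → e ∈ edgesAvoiding ends v → ¬ Incident ends e v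
  ∈-avoiding⁻ v = ∈-select⁻ (λ e → ¬? (incident? e v))

  conn-trans : ∀ {X u v w} → Conn ends X u v → Conn ends X v w → Conn ends X u w
  conn-trans here d = d
  conn-trans (step e e∈ j c) d = step e e∈ j (conn-trans c d)

  conn-edge : ∀ {X u v e} → e ∈ X → Joins ends e u v → Conn ends X u v
  conn-edge e∈ j = step _ e∈ j here

  conn-sym : ∀ {X u v} → Conn ends X u v → Conn ends X v u
  conn-sym here = here
  conn-sym (step e e∈ j c) = conn-trans (conn-sym c) (conn-edge e∈ (joins-sym j))

  conn-mono : ∀ {X Y u v} → X ⊆ Y → Conn ends X u v → Conn ends Y u v
  conn-mono X⊆Y here = here
  conn-mono X⊆Y (step e e∈ j c) = step e (X⊆Y e∈) j (conn-mono X⊆Y c)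

  Closed : Subset n → Subset m → Set
  Closed Z S = ∀ {e u w} → e ∈ Z → Joins ends e u w → u ∈ S → w ∈ S

  conn-closed : ∀ {X S u v} → Closed X S → Conn ends X u v → u ∈ S → v ∈ S
  conn-closed cl here u∈ = u∈
  conn-closed cl (step e e∈ j c) u∈ = conn-closed cl c (cl e∈ j u∈)

  closed-∁ : ∀ {Z S} → Closed Z S → Closed Z (∁ S)
  closed-∁ cl e∈ j u∈ = x∉p⇒x∈∁p (λ w∈ → x∈∁p⇒x∉p u∈ (cl e∈ (joins-sym j) w∈))

  -- The order in which vertices are attached is recorded because rank estimates gain one for every
  -- attachment.
  data Grow (Z : Subset n) : Subset m → Subset m → Set where
    done : ∀ {S} → Grow Z S S
    add  : ∀ {S S′ u w} e → e ∈ Z → Joins ends e u w → u ∈ S → w ∉ S →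
           Grow Z (S ∪ ⁅ w ⁆) S′ → Grow Z S S′

  grow-⊇ : ∀ {Z S S′} → Grow Z S S′ → S ⊆ S′
  grow-⊇ done x∈ = x∈
  grow-⊇ (add _ _ _ _ _ g) x∈ = grow-⊇ g (∈-insertˡ x∈)

  -- Closedness of `T` is asked only for steps that end in `S′`. This allows comparing hulls that
  -- avoid different vertex sets.
  grow-⊆ : ∀ {Z S S′ T} → Grow Z S S′ → S ⊆ T →
           (∀ {e u w} → e ∈ Z → Joins ends e u w → u ∈ T → w ∈ S′ → w ∈ T) → S′ ⊆ T
  grow-⊆ done S⊆T _ = S⊆T
  grow-⊆ {S = S} (add e e∈ j u∈ w∉ g) S⊆T cl =
    grow-⊆ g (insert-⊆ S⊆T (cl e∈ j (S⊆T u∈) (grow-⊇ g (∈-insertʳ S _)))) cl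

  grow-conn : ∀ {Z S S′ a} → Grow Z S S′ →
              (∀ {u} → u ∈ S → Conn ends Z a u) → ∀ {u} → u ∈ S′ → Conn ends Z a u
  grow-conn done c = c
  grow-conn {S = S} {a = a} (add {w = w} e e∈ j u∈ w∉ g) c = grow-conn g c′
    where
    c′ : ∀ {x} → x ∈ S ∪ ⁅ w ⁆ → Conn ends _ a x
    c′ x∈ with ∈-insert⁻ S x∈
    ... | inj₁ x∈S  = c x∈S
    ... | inj₂ refl = conn-trans (c u∈) (conn-edge e∈ j)

  grow-conn-⁅⁆ : ∀ {Z a S′} → Grow Z ⁅ a ⁆ S′ → ∀ {u} → u ∈ S′ → Conn ends Z a u
  grow-conn-⁅⁆ {a = a} g = grow-conn g (λ u∈ → subst (Conn ends _ a) (sym (x∈⁅y⁆⇒x≡y a u∈)) here)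

  -- `hull` is the set reachable from `S` along edges of `Z` through vertices of `W`: `grow` says
  -- that all of it is reached, `closed` that nothing is missed.
  record Closure (Z : Subset n) (W S : Subset m) : Set where
    field
      hull   : Subset m
      grow   : Grow Z S hull
      inside-W : hull ⊆ W
      closed : ∀ {e u w} → e ∈ Z → Joins ends e u w → u ∈ hull → w ∈ W → w ∈ hull

    ⊇-start : S ⊆ hull
    ⊇-start = grow-⊇ grow

  abstract
    closure : ∀ Z {W S} → S ⊆ W → Closure Z W S
    closure Z {W} {S} S⊆W = go m S⊆W (m≤m+n m ∣ S ∣)
      where
      leaving? : ∀ S → Dec (∃[ e ] (e ∈ Z × ((src e ∈ S × tgt e ∈ W × tgt e ∉ S)
                                            ⊎ (tgt e ∈ S × src e ∈ W × src e ∉ S))))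
      leaving? S = Fin.any? (λ e → (e ∈? Z) ×-dec
        (((src e ∈? S) ×-dec ((tgt e ∈? W) ×-dec ¬? (tgt e ∈? S)))
         ⊎-dec ((tgt e ∈? S) ×-dec ((src e ∈? W) ×-dec ¬? (src e ∈? S)))))
      go : ∀ d {S} → S ⊆ W → m ≤ d + ∣ S ∣ → Closure Z W S
      extend : ∀ d {S u w} e → e ∈ Z → Joins ends e u w → u ∈ S → w ∈ W → w ∉ S →
               S ⊆ W → m ≤ d + ∣ S ∣ → Closure Z W S
      -- With the fuel used up, `S` already has `m` vertices and leaves no room for `w`.
      extend zero {S} {w = w} e _ _ _ _ w∉S _ m≤ =
        ⊥-elim (<⇒≱ (subst (_≤ m) (insert-card S w∉S) (∣p∣≤n (S ∪ ⁅ w ⁆))) m≤)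
      extend (suc d) {S} {w = w} e e∈ j u∈ w∈W w∉S S⊆W m≤ = record
        { hull = hull ; grow = add e e∈ j u∈ w∉S grow ; inside-W = inside-W ; closed = closed }
        where
        open Closure (go d (insert-⊆ S⊆W w∈W)
          (subst (m ≤_) (trans (sym (+-suc d _)) (cong (d +_) (sym (insert-card S w∉S)))) m≤))
      go d {S} S⊆W m≤ with leaving? S
      ... | yes (e , e∈ , inj₁ (s , t , t∉)) = extend d e e∈ (joins-ends e) s t t∉ S⊆W m≤
      ... | yes (e , e∈ , inj₂ (t , s , s∉)) = extend d e e∈ (joins-sym (joins-ends e)) t s s∉ S⊆W m≤
      ... | no none = record { hull = S ; grow = done ; inside-W = S⊆W ; closed = closed }
        where
        closed : ∀ {e u w} → e ∈ Z → Joins ends e u w → u ∈ S → w ∈ W → w ∈ S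
        closed {e} {u} {w} e∈ j u∈ w∈ with w ∈? S
        closed {e} {u} {w} e∈ j u∈ w∈ | yes w∈S = w∈S
        closed {e} e∈ (inj₁ (refl , refl)) u∈ w∈ | no w∉S = ⊥-elim (none (e , e∈ , inj₁ (u∈ , w∈ , w∉S)))
        closed {e} e∈ (inj₂ (refl , refl)) u∈ w∈ | no w∉S = ⊥-elim (none (e , e∈ , inj₂ (u∈ , w∈ , w∉S)))

-- Rank bounds in a framework.

module Framework {n m : ℕ} (M : Matroid n) (ends : Ends n m) (F : IsFramework M ends) where
  open Rank M
  open Graph ends
  open IsFramework F

  -- Condition (3) at `w`: an edge spanned by the edges that avoid `w` avoids `w` itself or is a
  -- loop-edge there, and `e` does neither. All of `B` avoids `w`.
  link-rank : ∀ {B u w} e → Joins ends e u w → u ≢ w → (∀ {f} → f ∈ B → ¬ Incident ends f w) →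
              suc (r B) ≤ r (B ∪ ⁅ e ⁆)
  link-rank {B} {u} {w} e j u≢w B∌w =
    rank-insert (λ f∈ → ∈-avoiding⁺ w (B∌w f∈)) e∉cl
    where
    e∉cl : ¬ InCl M (edgesAvoiding ends w) e
    e∉cl e∈cl with cond3 w e e∈cl
    ... | inj₁ e∈ = ∈-avoiding⁻ w e∈ (joins-incident (joins-sym j))
    ... | inj₂ (s≡w , t≡w) with incident-joins (joins-sym (inj₁ (s≡w , t≡w))) (joins-incident j)
    ...   | inj₁ u≡w = u≢w u≡w
    ...   | inj₂ u≡w = u≢w u≡w

  -- Each attached vertex is new to the edges collected so far, so its edge raises the rank by
  -- `link-rank`. The edges of `B` may lie anywhere, provided that they meet `S′` only in `S`.
  grow-rank : ∀ {Z S S′ B R} → Grow Z S S′ →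
    (∀ {e u} → e ∈ B → Incident ends e u → u ∈ S′ → u ∈ S) →
    B ⊆ R → (∀ {e} → e ∈ Z → e ∈ within S′ → e ∈ R) → r B + ∣ S′ ∣ ≤ r R + ∣ S ∣
  grow-rank done _ B⊆R _ = +-monoˡ-≤ _ (rank-mono B⊆R)
  grow-rank {S = S} {S′} {B} {R} (add {u = u} {w} e e∈ j u∈ w∉ g) away B⊆R Z⊆R =
    ≤-pred (begin
      suc (r B + ∣ S′ ∣)         ≤⟨ +-monoˡ-≤ ∣ S′ ∣ (link-rank e j (λ { refl → w∉ u∈ }) B∌w) ⟩
      r (B ∪ ⁅ e ⁆) + ∣ S′ ∣     ≤⟨ grow-rank g away′ (insert-⊆ B⊆R e∈R) Z⊆R ⟩
      r R + ∣ S ∪ ⁅ w ⁆ ∣        ≡⟨ cong (r R +_) (insert-card S w∉) ⟩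
      r R + suc ∣ S ∣            ≡⟨ +-suc (r R) ∣ S ∣ ⟩
      suc (r R + ∣ S ∣)          ∎)
    where
    open ≤-Reasoning
    w∈S′ : w ∈ S′
    w∈S′ = grow-⊇ g (∈-insertʳ S w)
    B∌w : ∀ {f} → f ∈ B → ¬ Incident ends f w
    B∌w f∈ inc = w∉ (away f∈ inc w∈S′)
    e∈R : e ∈ R
    e∈R = Z⊆R e∈ (joins-within⁺ S′ j (grow-⊇ g (∈-insertˡ u∈)) w∈S′)
    -- The new edge meets only `u` and `w`, both of which belong to the enlarged set.
    away′ : ∀ {f x} → f ∈ B ∪ ⁅ e ⁆ → Incident ends f x → x ∈ S′ → x ∈ S ∪ ⁅ w ⁆
    away′ f∈ inc x∈ with ∈-insert⁻ B f∈
    ... | inj₁ f∈B = ∈-insertˡ (away f∈B inc x∈)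
    ... | inj₂ refl with incident-joins j inc
    ...   | inj₁ refl = ∈-insertˡ u∈
    ...   | inj₂ refl = ∈-insertʳ S w

  component : ∀ a → Closure Full Full ⁅ a ⁆
  component a = closure Full ⊆⊤

  component-rank : ∀ a → r (within (Closure.hull (component a))) ≤ ∣ Closure.hull (component a) ∣
  component-rank a = ≤-trans (rank-mono within⊆) (cond2 hull
    ((a , ⊇-start (x∈⁅x⁆ a)) , (λ e u w u∈ j → closed ∈⊤ j u∈ ∈⊤) ,
      λ u v u∈ v∈ → conn-trans (conn-sym (grow-conn-⁅⁆ grow u∈)) (grow-conn-⁅⁆ grow v∈)))
    where
    open Closure (component a)
    within⊆ : within hull ⊆ edgesOf ends hull
    within⊆ e∈ = ∈-select⁺ (λ e → src e ∈? hull) (proj₁ (∈-within⁻ hull e∈))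

  -- A closed set is a union of components. One component is split off at a time, and condition (2)
  -- bounds its rank.
  closed-rank : ∀ {S} → Closed Full S → r (within S) ≤ ∣ S ∣
  closed-rank {S} = go ∣ S ∣ ≤-refl
    where
    go : ∀ d {S} → ∣ S ∣ ≤ d → Closed Full S → r (within S) ≤ ∣ S ∣
    go d {S} S≤d cl with nonempty? S
    go d {S} S≤d cl | no empty = ≤-trans (rank≤card _)
      (≤-trans (≤-reflexive (∅-card (λ e∈ → empty (_ , proj₁ (∈-within⁻ S e∈))))) z≤n)
    go zero S≤d cl | yes (a , a∈) = ⊥-elim (<⇒≱ (nonempty-card a∈) S≤d)
    go (suc d) {S} S≤d cl | yes (a , a∈) = begin
      r (within S)                          ≤⟨ subadditive split ⟩
      r (within hull) + r (within (S ─ hull))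
        ≤⟨ +-mono-≤ (component-rank a) (go d smaller closed′) ⟩
      ∣ hull ∣ + ∣ S ─ hull ∣               ≤⟨ size ⟩
      ∣ S ∣                                 ∎
      where
      open ≤-Reasoning
      open Closure (component a)
      hull⊆S : hull ⊆ S
      hull⊆S = grow-⊆ grow (⁅⁆-⊆ a∈) (λ e∈ j u∈ _ → cl e∈ j u∈)
      size : ∣ hull ∣ + ∣ S ─ hull ∣ ≤ ∣ S ∣
      size = disjoint-card hull⊆S (p─q⊆p S hull) (λ x∈ x∈′ → proj₂ (∈-─⁻ S hull x∈′) x∈)
      smaller : ∣ S ─ hull ∣ ≤ d
      smaller = ≤-pred (≤-trans (+-monoˡ-≤ _ (nonempty-card (⊇-start (x∈⁅x⁆ a)))) (≤-trans size S≤d))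
      closed′ : Closed Full (S ─ hull)
      closed′ e∈ j u∈ with ∈-─⁻ S hull u∈
      ... | u∈S , u∉ = x∈p∧x∉q⇒x∈p─q (cl e∈ j u∈S) (λ w∈ → u∉ (closed e∈ (joins-sym j) w∈ ∈⊤))
      split : ∀ {e} → e ∈ within S → e ∈ within hull ⊎ e ∈ within (S ─ hull)
      split {e} e∈ with ∈-within⁻ S e∈ | src e ∈? hull
      ... | s , t | yes s∈ = inj₁ (∈-within⁺ hull s∈ (closed ∈⊤ (joins-ends e) s∈ ∈⊤))
      ... | s , t | no s∉ = inj₂ (∈-within⁺ (S ─ hull) s′ (closed′ ∈⊤ (joins-ends e) s′))
        where
        s′ : src e ∈ S ─ hull
        s′ = x∈p∧x∉q⇒x∈p─q s s∉

  -- `S` grows to the union of the components that it meets. Each step adds one vertex and at least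
  -- one to the rank, so the bound for the closed set passes back to `S`.
  rank-within : ∀ S → r (within S) ≤ ∣ S ∣
  rank-within S = +-cancelʳ-≤ ∣ hull ∣ _ _ (begin
    r (within S) + ∣ hull ∣      ≤⟨ grow-rank grow (λ e∈ inc _ → within-incident S e∈ inc)
                                      (within-mono ⊇-start) (λ _ e∈ → e∈) ⟩
    r (within hull) + ∣ S ∣      ≤⟨ +-monoˡ-≤ ∣ S ∣ (closed-rank (λ e∈ j u∈ → closed e∈ j u∈ ∈⊤)) ⟩
    ∣ hull ∣ + ∣ S ∣             ≡⟨ +-comm ∣ hull ∣ ∣ S ∣ ⟩
    ∣ S ∣ + ∣ hull ∣             ∎)
    where
    open ≤-Reasoning
    open Closure (closure Full {Full} {S} ⊆⊤)

-- Extending a matroid by an element parallel to `e`.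

module ParallelExtension {n : ℕ} (M : Matroid n) (e : Fin n) where

  -- The new element `zero` is a parallel copy of `e`: it can be traded for `e`, and the two never
  -- occur together.
  Indep⁺ : Subset (suc n) → Set
  Indep⁺ (outside ∷ X) = Indep M X
  Indep⁺ (inside ∷ X)  = e ∉ X × Indep M (X ∪ ⁅ e ⁆)

  parallel : Matroid (suc n)
  parallel = record
    { Indep     = Indep⁺
    ; Indep?    = indep?
    ; indep-∅   = indep-∅ M
    ; indep-⊆   = λ {I} {J} → hereditary I J
    ; indep-aug = λ {I} {J} → augment I J
    }
    where
    indep? : ∀ X → Dec (Indep⁺ X)
    indep? (outside ∷ X) = Indep? M X
    indep? (inside ∷ X)  = ¬? (e ∈? X) ×-dec Indep? M (X ∪ ⁅ e ⁆)

    hereditary : ∀ I J → J ⊆ I → Indep⁺ I → Indep⁺ J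
    hereditary (outside ∷ X) (outside ∷ Y) J⊆I ind = indep-⊆ M (drop-∷-⊆ J⊆I) ind
    hereditary (outside ∷ X) (inside ∷ Y)  J⊆I ind with () ← J⊆I here
    hereditary (inside ∷ X)  (outside ∷ Y) J⊆I (_ , ind) =
      indep-⊆ M (∈-insertˡ ∘ drop-∷-⊆ J⊆I) ind
    hereditary (inside ∷ X)  (inside ∷ Y)  J⊆I (e∉X , ind) =
      e∉X ∘ drop-∷-⊆ J⊆I , indep-⊆ M (insert-mono (drop-∷-⊆ J⊆I)) ind

    Augment : Subset (suc n) → Subset (suc n) → Set
    Augment I J = ∃[ x ] (x ∈ J × x ∉ I × Indep⁺ (I ∪ ⁅ x ⁆))

    augment-inside : ∀ {X Y j} → e ∉ X →
      ∃[ x ] (x ∈ Y × x ∉ X ∪ ⁅ e ⁆ × Indep M ((X ∪ ⁅ e ⁆) ∪ ⁅ x ⁆)) → Augment (inside ∷ X) (j ∷ Y)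
    augment-inside {X} e∉X (x , x∈Y , x∉ , ind) = suc x , there x∈Y ,
      (λ { (there x∈X) → x∉ (∈-insertˡ x∈X) }) ,
      (λ e∈ → [ e∉X , (λ { refl → x∉ (∈-insertʳ X e) }) ]′ (∈-insert⁻ X e∈)) ,
      indep-⊆ M (insert-⊆ (insert-mono ∈-insertˡ) (∈-insertˡ (∈-insertʳ X e))) ind

    augment : ∀ I J → Indep⁺ I → Indep⁺ J → ∣ I ∣ < ∣ J ∣ → Augment I J
    augment (outside ∷ X) (outside ∷ Y) indX indY X<Y with indep-aug M indX indY X<Y
    ... | x , x∈Y , x∉X , ind = suc x , there x∈Y , (λ { (there x∈X) → x∉X x∈X }) , ind
    augment (outside ∷ X) (inside ∷ Y) indX (e∉Y , indY) X<Y
      with indep-aug M indX indY (subst (∣ X ∣ <_) (sym (insert-card Y e∉Y)) X<Y)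
    ... | x , x∈ , x∉X , ind with ∈-insert⁻ Y x∈
    ...   | inj₁ x∈Y = suc x , there x∈Y , (λ { (there x∈X) → x∉X x∈X }) , ind
    -- The element found is `e`, which stands for `zero` in `J`, so `zero` is the element to add.
    ...   | inj₂ refl = zero , here , (λ ()) ,
      (λ e∈ → [ x∉X , ∉⊥ ]′ (x∈p∪q⁻ X ∅ e∈)) ,
      indep-⊆ M (insert-mono (∪-⊆ ⊆-refl ⊥⊆)) ind
    augment (inside ∷ X) (outside ∷ Y) (e∉X , indX) indY X<Y = augment-inside e∉X
      (indep-aug M indX indY (subst (_< ∣ Y ∣) (sym (insert-card X e∉X)) X<Y))
    augment (inside ∷ X) (inside ∷ Y) (e∉X , indX) (e∉Y , indY) (s≤s X<Y)
      with indep-aug M indX indY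
             (subst (_< ∣ Y ∪ ⁅ e ⁆ ∣) (sym (insert-card X e∉X))
               (subst (suc ∣ X ∣ <_) (sym (insert-card Y e∉Y)) (s≤s X<Y)))
    ... | x , x∈ , x∉ , ind with ∈-insert⁻ Y x∈
    ...   | inj₁ x∈Y = augment-inside e∉X (x , x∈Y , x∉ , ind)
    ...   | inj₂ refl = ⊥-elim (x∉ (∈-insertʳ X x))

-- Forests and counting edges within vertex sets.

module Forests {n m : ℕ} (ends : Ends n m) where
  open Graph ends

  forest-joins : ∀ {X f u w} → Forest ends X → f ∈ X → Joins ends f u w → ¬ Conn ends (X - f) u w
  forest-joins for f∈ (inj₁ (refl , refl)) c = for _ f∈ c
  forest-joins for f∈ (inj₂ (refl , refl)) c = for _ f∈ (conn-sym c)

  -- `T` collects the vertices of a walk. Each vertex that is new on arrival brings an edge that is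
  -- new within `T`, so the edges never fall more than one behind the vertices.
  conn-count : ∀ {Y S u b} → Conn ends Y u b → u ∈ S → ∣ S ∣ ≤ suc ∣ Y ∩ within S ∣ →
    ∃[ T ] (S ⊆ T × b ∈ T × ∣ T ∣ ≤ suc ∣ Y ∩ within T ∣)
  conn-count here u∈ cnt = _ , ⊆-refl , u∈ , cnt
  conn-count {Y} {S} (step {w = w} e e∈ j c) u∈ cnt with w ∈? S
  ... | yes w∈ = conn-count c w∈ cnt
  ... | no w∉ = let (T , S+w⊆T , b∈ , cnt′) = conn-count c (∈-insertʳ S w) grown
                in T , S+w⊆T ∘ ∈-insertˡ , b∈ , cnt′
    where
    open ≤-Reasoning
    e∉ : e ∉ Y ∩ within S
    e∉ e∈′ = w∉ (proj₂ (joins-within⁻ S j (proj₂ (x∈p∩q⁻ Y _ e∈′))))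
    grown : ∣ S ∪ ⁅ w ⁆ ∣ ≤ suc ∣ Y ∩ within (S ∪ ⁅ w ⁆) ∣
    grown = begin
      ∣ S ∪ ⁅ w ⁆ ∣                        ≡⟨ insert-card S w∉ ⟩
      suc ∣ S ∣                            ≤⟨ s≤s cnt ⟩
      suc (suc ∣ Y ∩ within S ∣)           ≡⟨ cong suc (insert-card (Y ∩ within S) e∉) ⟨
      suc ∣ (Y ∩ within S) ∪ ⁅ e ⁆ ∣
        ≤⟨ s≤s (p⊆q⇒∣p∣≤∣q∣ (insert-⊆
             (λ x∈ → let (a , b) = x∈p∩q⁻ Y _ x∈ in x∈p∩q⁺ (a , within-mono ∈-insertˡ b))
             (x∈p∩q⁺ (e∈ , joins-within⁺ (S ∪ ⁅ w ⁆) j (∈-insertˡ u∈) (∈-insertʳ S w))))) ⟩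
      suc ∣ Y ∩ within (S ∪ ⁅ w ⁆) ∣       ∎

  -- A walk in `X - f` between the ends of `f` yields a set `T` with at least |T| - 1 edges of
  -- `X - f` inside; together with `f` there are at least |T|, against sparsity.
  sparse⇒forest : ∀ {X} → (∀ {S} → Nonempty S → ∣ X ∩ within S ∣ < ∣ S ∣) → Forest ends X
  sparse⇒forest {X} sparse f f∈ c
    with conn-count c (x∈⁅x⁆ (src f)) (≤-trans (≤-reflexive (∣⁅x⁆∣≡1 (src f))) (s≤s z≤n))
  ... | T , a⊆T , t∈ , cnt = <⇒≱ (sparse (src f , s∈)) (begin
    ∣ T ∣                                   ≤⟨ cnt ⟩
    suc ∣ (X - f) ∩ within T ∣              ≡⟨ insert-card ((X - f) ∩ within T) f∉ ⟨
    ∣ ((X - f) ∩ within T) ∪ ⁅ f ⁆ ∣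
      ≤⟨ p⊆q⇒∣p∣≤∣q∣ (insert-⊆
           (λ x∈ → let (a , b) = x∈p∩q⁻ (X - f) _ x∈ in x∈p∩q⁺ (p─q⊆p X ⁅ f ⁆ a , b))
           (x∈p∩q⁺ (f∈ , ∈-within⁺ T s∈ t∈))) ⟩
    ∣ X ∩ within T ∣                        ∎)
    where
    open ≤-Reasoning
    s∈ : src f ∈ T
    s∈ = a⊆T (x∈⁅x⁆ (src f))
    f∉ : f ∉ (X - f) ∩ within T
    f∉ x∈ = proj₂ (∈-─⁻ X ⁅ f ⁆ (proj₁ (x∈p∩q⁻ (X - f) _ x∈))) (x∈⁅x⁆ f)

-- A lifted-graphic representation from the rank bound.

module Lift {n m : ℕ} (M : Matroid n) (ends : Ends n m) (F : IsFramework M ends)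
  (e : Fin n) (e-loop : proj₁ (ends e) ≡ proj₂ (ends e)) (e-indep : Indep M ⁅ e ⁆) where
  open Rank M
  open Graph ends
  open Forests ends
  open Framework M ends F
  open ParallelExtension M e

  -- A forest is built up from the end of e, either along an edge of the forest
  -- or, when no such edge leaves S, by a new isolated vertex.
  record Processed (X : Subset n) (S : Subset m) : Set where
    field
      root   : src e ∈ S
      local  : ∀ {s t} → s ∈ S → t ∈ S → Conn ends X s t → Conn ends (X ∩ within S) s t
      indep  : Indep M ((X ∩ within S) ∪ ⁅ e ⁆)

  module _ {X : Subset n} (for : Forest ends X) where

    no-loop : ∀ {f u} → f ∈ X → ¬ Joins ends f u u
    no-loop f∈ j = forest-joins for f∈ j here

    -- In a forest `f` is the only edge from `S` to `w`, so exactly one element is added, and it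
    -- raises the rank because nothing before it meets `w`.
    process-link : ∀ {S f u w} → Processed X S → f ∈ X → Joins ends f u w → u ∈ S → w ∉ S →
                   Processed X (S ∪ ⁅ w ⁆)
    process-link {S} {f} {u} {w} P f∈ j u∈ w∉ = record
      { root = ∈-insertˡ root ; local = local′ ; indep = indep-⊆ M edges (rank⇒indep big) }
      where
      open Processed P
      S′ = S ∪ ⁅ w ⁆
      A = (X ∩ within S) ∪ ⁅ e ⁆
      X∩⊆ : X ∩ within S ⊆ X ∩ within S′
      X∩⊆ x∈ = let (a , b) = x∈p∩q⁻ X _ x∈ in x∈p∩q⁺ (a , within-mono ∈-insertˡ b)
      f∈′ : f ∈ X ∩ within S′
      f∈′ = x∈p∩q⁺ (f∈ , joins-within⁺ S′ j (∈-insertˡ u∈) (∈-insertʳ S w))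
      X∩⊆X-f : X ∩ within S ⊆ X - f
      X∩⊆X-f x∈ = let (a , b) = x∈p∩q⁻ X _ x∈ in
        x∈p∧x≢y⇒x∈p-y a (λ { refl → w∉ (proj₂ (joins-within⁻ S j b)) })
      into : ∀ {s} → s ∈ S′ → ∃[ t ] (t ∈ S × Conn ends (X ∩ within S′) s t)
      into s∈ with ∈-insert⁻ S s∈
      ... | inj₁ s∈S  = _ , s∈S , here
      ... | inj₂ refl = u , u∈ , conn-edge f∈′ (joins-sym j)
      local′ : ∀ {s t} → s ∈ S′ → t ∈ S′ → Conn ends X s t → Conn ends (X ∩ within S′) s t
      local′ s∈ t∈ c with into s∈ | into t∈
      ... | s₀ , s₀∈ , cs | t₀ , t₀∈ , ct = conn-trans cs (conn-trans
        (conn-mono X∩⊆ (local s₀∈ t₀∈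
          (conn-trans (conn-sym (conn-mono (p∩q⊆p X _) cs)) (conn-trans c (conn-mono (p∩q⊆p X _) ct)))))
        (conn-sym ct))
      -- A second edge `g` from `S` to `w` would, with the connection that `local` keeps inside `S`,
      -- join the ends of `f` in `X - f`.
      new-edge : ∀ {g x} → g ∈ X → Joins ends g x w → x ∈ S′ → g ∈ X ∩ within S ⊎ g ≡ f
      new-edge {g} {x} g∈ jg x∈ with ∈-insert⁻ S x∈
      ... | inj₂ refl = ⊥-elim (no-loop g∈ jg)
      ... | inj₁ x∈S with g ≟ᶠ f
      ...   | yes g≡f = inj₂ g≡f
      ...   | no g≢f = ⊥-elim (forest-joins for f∈ j (conn-trans
        (conn-mono X∩⊆X-f (local u∈ x∈S (conn-trans (conn-edge f∈ j) (conn-edge g∈ (joins-sym jg)))))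
        (conn-edge (x∈p∧x≢y⇒x∈p-y g∈ g≢f) jg)))
      edge : ∀ {g} → g ∈ X ∩ within S′ → g ∈ X ∩ within S ⊎ g ≡ f
      edge {g} g∈′ with x∈p∩q⁻ X _ g∈′
      ... | g∈ , g∈S′ with ∈-within⁻ S′ g∈S′
      ... | s∈ , t∈ with ∈-insert⁻ S s∈ | ∈-insert⁻ S t∈
      ... | inj₁ s∈S | inj₁ t∈S = inj₁ (x∈p∩q⁺ (g∈ , ∈-within⁺ S s∈S t∈S))
      ... | inj₂ refl | _ = new-edge g∈ (joins-sym (joins-ends g)) t∈
      ... | inj₁ _ | inj₂ refl = new-edge g∈ (joins-ends g) s∈
      edges : (X ∩ within S′) ∪ ⁅ e ⁆ ⊆ A ∪ ⁅ f ⁆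
      edges = insert-⊆ (λ g∈ → [ (λ g∈′ → ∈-insertˡ (∈-insertˡ g∈′)) , (λ { refl → ∈-insertʳ A f }) ]′ (edge g∈))
                (∈-insertˡ (∈-insertʳ (X ∩ within S) e))
      A∌w : ∀ {g} → g ∈ A → ¬ Incident ends g w
      A∌w g∈ inc with ∈-insert⁻ (X ∩ within S) g∈
      ... | inj₁ g∈′ = w∉ (within-incident S (proj₂ (x∈p∩q⁻ X _ g∈′)) inc)
      A∌w g∈ (inj₁ refl) | inj₂ refl = w∉ root
      A∌w g∈ (inj₂ refl) | inj₂ refl = w∉ (subst (_∈ S) e-loop root)
      big : ∣ A ∪ ⁅ f ⁆ ∣ ≤ r (A ∪ ⁅ f ⁆)
      big = begin
        ∣ A ∪ ⁅ f ⁆ ∣    ≤⟨ insert-card-≤ A f ⟩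
        suc ∣ A ∣        ≡⟨ cong suc (indep⇒rank indep) ⟨
        suc (r A)        ≤⟨ link-rank f j (λ { refl → w∉ u∈ }) A∌w ⟩
        r (A ∪ ⁅ f ⁆)    ∎
        where open ≤-Reasoning

    -- No edge of `X` leads from the closed set `S` to `w`, and a forest has no loop at `w`, so the
    -- edge set does not change.
    process-isolated : ∀ {S w} → Processed X S → Closed X S → w ∉ S → Processed X (S ∪ ⁅ w ⁆)
    process-isolated {S} {w} P cl w∉ = record
      { root = ∈-insertˡ root ; local = local′ ; indep = indep-⊆ M (insert-mono edges) indep }
      where
      open Processed P
      S′ = S ∪ ⁅ w ⁆
      X∩⊆ : X ∩ within S ⊆ X ∩ within S′
      X∩⊆ x∈ = let (a , b) = x∈p∩q⁻ X _ x∈ in x∈p∩q⁺ (a , within-mono ∈-insertˡ b)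
      apart : ∀ {t} → t ∈ S → ¬ Conn ends X t w
      apart t∈ c = w∉ (conn-closed cl c t∈)
      local′ : ∀ {s t} → s ∈ S′ → t ∈ S′ → Conn ends X s t → Conn ends (X ∩ within S′) s t
      local′ s∈ t∈ c with ∈-insert⁻ S s∈ | ∈-insert⁻ S t∈
      ... | inj₁ s∈S  | inj₁ t∈S  = conn-mono X∩⊆ (local s∈S t∈S c)
      ... | inj₁ s∈S  | inj₂ refl = ⊥-elim (apart s∈S c)
      ... | inj₂ refl | inj₁ t∈S  = ⊥-elim (apart t∈S (conn-sym c))
      ... | inj₂ refl | inj₂ refl = here
      edges : X ∩ within S′ ⊆ X ∩ within S
      edges {g} g∈′ with x∈p∩q⁻ X _ g∈′
      ... | g∈ , g∈S′ with ∈-within⁻ S′ g∈S′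
      ... | s∈ , t∈ with ∈-insert⁻ S s∈ | ∈-insert⁻ S t∈
      ... | inj₁ s∈S | inj₁ t∈S = x∈p∩q⁺ (g∈ , ∈-within⁺ S s∈S t∈S)
      ... | inj₁ s∈S | inj₂ refl = ⊥-elim (w∉ (cl g∈ (joins-ends g) s∈S))
      ... | inj₂ refl | inj₁ t∈S = ⊥-elim (w∉ (cl g∈ (joins-sym (joins-ends g)) t∈S))
      ... | inj₂ p | inj₂ q = ⊥-elim (no-loop g∈ (inj₁ (p , q)))

    process-grow : ∀ {S S′} → Grow X S S′ → Processed X S → Processed X S′
    process-grow done P = P
    process-grow (add f f∈ j u∈ w∉ g) P = process-grow g (process-link P f∈ j u∈ w∉)

    -- Alternates between growing along `X` as far as possible and adding one vertex from outside;
    -- `d` bounds the number of vertices still to come.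
    process-all : ∀ d {S} → m ≤ d + ∣ S ∣ → Processed X S → ∃[ T ] (Full ⊆ T × Processed X T)
    process-all d {S} m≤ P with nonempty? (∁ hull)
      where open Closure (closure X {Full} {S} ⊆⊤)
    ... | no empty = _ , (λ {x} _ → x∉∁p⇒x∈p (λ x∈ → empty (x , x∈))) ,
                     process-grow (Closure.grow (closure X {Full} {S} ⊆⊤)) P
    process-all zero {S} m≤ P | yes (w , w∈) = ⊥-elim (<⇒≱ (begin
      suc ∣ S ∣            ≡⟨ insert-card S w∉S ⟨
      ∣ S ∪ ⁅ w ⁆ ∣        ≤⟨ ∣p∣≤n (S ∪ ⁅ w ⁆) ⟩
      m                    ∎) m≤)
      where
      open ≤-Reasoning
      w∉S : w ∉ S
      w∉S w∈S = x∈∁p⇒x∉p w∈ (Closure.⊇-start (closure X {Full} {S} ⊆⊤) w∈S)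
    process-all (suc d) {S} m≤ P | yes (w , w∈) =
      process-all d (begin
        m                          ≤⟨ m≤ ⟩
        suc d + ∣ S ∣              ≤⟨ +-monoʳ-≤ (suc d) (p⊆q⇒∣p∣≤∣q∣ ⊇-start) ⟩
        suc d + ∣ hull ∣           ≡⟨ +-suc d ∣ hull ∣ ⟨
        d + suc ∣ hull ∣           ≡⟨ cong (d +_) (insert-card hull w∉) ⟨
        d + ∣ hull ∪ ⁅ w ⁆ ∣       ∎)
        (process-isolated (process-grow grow P) (λ f∈ j u∈ → closed f∈ j u∈ ∈⊤) w∉)
      where
      open ≤-Reasoning
      open Closure (closure X {Full} {S} ⊆⊤)
      w∉ : w ∉ hull
      w∉ = x∈∁p⇒x∉p w∈

    forest⇒indep : Indep⁺ (inside ∷ X)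
    forest⇒indep = (λ e∈ → no-loop e∈ (inj₁ (refl , sym e-loop))) ,
      indep-⊆ M (insert-mono (λ x∈ → x∈p∩q⁺ (x∈ , ∈-within⁺ T (full ∈⊤) (full ∈⊤)))) (Processed.indep P)
      where
      start : Processed X ⁅ src e ⁆
      start = record
        { root = x∈⁅x⁆ (src e)
        ; local = λ s∈ t∈ _ → subst (Conn ends _ _)
            (trans (x∈⁅y⁆⇒x≡y (src e) s∈) (sym (x∈⁅y⁆⇒x≡y (src e) t∈))) here
        -- A forest has no loop, so at a single vertex only `e` remains.
        ; indep = indep-⊆ M (∪-⊆ (λ f∈ → ⊥-elim (
            let (f∈X , f∈W) = x∈p∩q⁻ X _ f∈ ; (s , t) = ∈-within⁻ ⁅ src e ⁆ f∈W in
            no-loop f∈X (inj₁ (x∈⁅y⁆⇒x≡y (src e) s , x∈⁅y⁆⇒x≡y (src e) t)))) ⊆-refl) e-indep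
        }
      all : ∃[ T ] (Full ⊆ T × Processed X T)
      all = process-all m (m≤m+n m _) start
      T = proj₁ all
      full = proj₁ (proj₂ all)
      P = proj₂ (proj₂ all)

  -- As `zero` has rank 1, the rank equation says that `X` together with `zero` is independent. The
  -- bound then leaves fewer than |S| edges of `X` within `S`, which makes `X` a forest;
  -- `forest⇒indep` is the converse.
  lifted-graphic : (∀ {S} → Nonempty S → r (within S ∪ ⁅ e ⁆) ≤ ∣ S ∣) → IsLiftedGraphic M
  lifted-graphic bound = parallel , (λ X → id , id) , m , ends , λ X → to X , from X
    where
    module R⁺ = Rank parallel
    r-zero : R⁺.r ⁅ zero ⁆ ≡ 1
    r-zero = trans (R⁺.indep⇒rank (∉⊥ , indep-⊆ M (∪-⊆ ⊥⊆ ⊆-refl) e-indep)) (∣⁅x⁆∣≡1 (zero {n}))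
    size : ∀ X → ∣ X ∣ + R⁺.r ⁅ zero ⁆ ≡ suc ∣ X ∣
    size X = trans (cong (∣ X ∣ +_) r-zero) (+-comm ∣ X ∣ 1)
    to : ∀ X → R⁺.r (inside ∷ X) ≡ ∣ X ∣ + R⁺.r ⁅ zero ⁆ → Forest ends X
    to X eq with R⁺.rank⇒indep {inside ∷ X} (≤-reflexive (sym (trans eq (size X))))
    ... | e∉ , ind = sparse⇒forest (λ {S} S≠∅ → begin
      suc ∣ X ∩ within S ∣            ≡⟨ insert-card (X ∩ within S) (e∉ ∘ p∩q⊆p X _) ⟨
      ∣ (X ∩ within S) ∪ ⁅ e ⁆ ∣
        ≤⟨ indep⇒≤rank (insert-mono (p∩q⊆q X _)) (indep-⊆ M (insert-mono (p∩q⊆p X _)) ind) ⟩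
      r (within S ∪ ⁅ e ⁆)            ≤⟨ bound S≠∅ ⟩
      ∣ S ∣                           ∎)
      where open ≤-Reasoning
    from : ∀ X → Forest ends X → R⁺.r (inside ∷ X) ≡ ∣ X ∣ + R⁺.r ⁅ zero ⁆
    from X for = trans (R⁺.indep⇒rank {inside ∷ X} (forest⇒indep for)) (sym (size X))

-- Subsets of a disjoint union, seen as pairs.

∈-take⁺ : ∀ m {n} (Z : Subset (m + n)) {x} → x ↑ˡ n ∈ Z → x ∈ take m Z
∈-take⁺ (suc m) (b ∷ Z) {zero}  here       = here
∈-take⁺ (suc m) (b ∷ Z) {suc x} (there x∈) = there (∈-take⁺ m Z x∈)

∈-take⁻ : ∀ m {n} (Z : Subset (m + n)) {x} → x ∈ take m Z → x ↑ˡ n ∈ Z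
∈-take⁻ (suc m) (b ∷ Z) {zero}  here       = here
∈-take⁻ (suc m) (b ∷ Z) {suc x} (there x∈) = there (∈-take⁻ m Z x∈)

∈-drop⁺ : ∀ m {n} (Z : Subset (m + n)) {x} → m ↑ʳ x ∈ Z → x ∈ drop m Z
∈-drop⁺ zero    Z       x∈                  = x∈
∈-drop⁺ (suc m) (b ∷ Z) (there x∈) = ∈-drop⁺ m Z x∈

∈-drop⁻ : ∀ m {n} (Z : Subset (m + n)) {x} → x ∈ drop m Z → m ↑ʳ x ∈ Z
∈-drop⁻ zero    Z       x∈ = x∈
∈-drop⁻ (suc m) (b ∷ Z) x∈ = there (∈-drop⁻ m Z x∈)

card-take-drop : ∀ m {n} (Z : Subset (m + n)) → ∣ Z ∣ ≡ ∣ take m Z ∣ + ∣ drop m Z ∣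
card-take-drop zero    Z             = refl
card-take-drop (suc m) (inside ∷ Z)  = cong suc (card-take-drop m Z)
card-take-drop (suc m) (outside ∷ Z) = card-take-drop m Z

take-++ : ∀ {m n} (T : Subset m) (X : Subset n) → take m (T ++ X) ≡ T
take-++ []      X = refl
take-++ (b ∷ T) X = cong (b ∷_) (take-++ T X)

drop-++ : ∀ {m n} (T : Subset m) (X : Subset n) → drop m (T ++ X) ≡ X
drop-++ []      X = refl
drop-++ (b ∷ T) X = drop-++ T X

↑ʳ≢↑ˡ : ∀ m {n} {x : Fin n} {y : Fin m} → m ↑ʳ x ≢ y ↑ˡ n
↑ʳ≢↑ˡ m {n} {x} {y} eq
  with () ← trans (sym (Fin.splitAt-↑ʳ m n x)) (trans (cong (splitAt m) eq) (Fin.splitAt-↑ˡ m y n))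

module _ {m n : ℕ} (Z : Subset (m + n)) where

  take-insertˡ : ∀ u → take m (Z ∪ ⁅ u ↑ˡ n ⁆) ⊆ take m Z ∪ ⁅ u ⁆
  take-insertˡ u x∈ with ∈-insert⁻ Z (∈-take⁻ m (Z ∪ ⁅ u ↑ˡ n ⁆) x∈)
  ... | inj₁ x∈Z = ∈-insertˡ (∈-take⁺ m Z x∈Z)
  ... | inj₂ eq with refl ← Fin.↑ˡ-injective n _ u eq = ∈-insertʳ (take m Z) u

  drop-insertˡ : ∀ u → drop m (Z ∪ ⁅ u ↑ˡ n ⁆) ⊆ drop m Z
  drop-insertˡ u x∈ with ∈-insert⁻ Z (∈-drop⁻ m (Z ∪ ⁅ u ↑ˡ n ⁆) x∈)
  ... | inj₁ x∈Z = ∈-drop⁺ m Z x∈Z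
  ... | inj₂ eq = ⊥-elim (↑ʳ≢↑ˡ m eq)

  take-insertʳ : ∀ y → take m (Z ∪ ⁅ m ↑ʳ y ⁆) ⊆ take m Z
  take-insertʳ y x∈ with ∈-insert⁻ Z (∈-take⁻ m (Z ∪ ⁅ m ↑ʳ y ⁆) x∈)
  ... | inj₁ x∈Z = ∈-take⁺ m Z x∈Z
  ... | inj₂ eq = ⊥-elim (↑ʳ≢↑ˡ m (sym eq))

  drop-insertʳ : ∀ y → drop m (Z ∪ ⁅ m ↑ʳ y ⁆) ⊆ drop m Z ∪ ⁅ y ⁆
  drop-insertʳ y x∈ with ∈-insert⁻ Z (∈-drop⁻ m (Z ∪ ⁅ m ↑ʳ y ⁆) x∈)
  ... | inj₁ x∈Z = ∈-insertˡ (∈-drop⁺ m Z x∈Z)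
  ... | inj₂ eq with refl ← Fin.↑ʳ-injective m _ y eq = ∈-insertʳ (drop m Z) y

-- A frame representation from skewness: adding a joint at each vertex.

module Frame {n m : ℕ} (M : Matroid n) (ends : Ends n m) (F : IsFramework M ends)
  (direct : ∀ A {X Y} → X ⊆ Graph.within ends A → Y ⊆ Graph.within ends (∁ A) →
            Indep M X → Indep M Y → Indep M (X ∪ Y)) where
  open Rank M
  open Graph ends
  open Framework M ends F

  -- A joint counts like one more loop-edge at its vertex.
  weight : Subset m → Subset n → Subset m → ℕ
  weight T X S = ∣ X ∩ within S ∣ + ∣ T ∩ S ∣

  -- Independence in the bicircular matroid of the graph with a joint added as a loop-edge at each
  -- vertex.
  Sparse : Subset m → Subset n → Set
  Sparse T X = ∀ S → weight T X S ≤ ∣ S ∣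

  sparse? : ∀ T X → Dec (Sparse T X)
  sparse? T X with anySubset? (λ S → ¬? (weight T X S ≤? ∣ S ∣))
  ... | yes (S , ¬ok) = no (λ ok → ¬ok (ok S))
  ... | no none = yes (λ S → decidable-stable (weight T X S ≤? ∣ S ∣) (λ ¬ok → none (S , ¬ok)))

  weight-mono : ∀ {T U X Y S} → T ⊆ U → X ⊆ Y → weight T X S ≤ weight U Y S
  weight-mono {T} {U} {X} {Y} {S} T⊆U X⊆Y = +-mono-≤ (p⊆q⇒∣p∣≤∣q∣ (∩-monoˡ X⊆Y)) (p⊆q⇒∣p∣≤∣q∣ (∩-monoˡ T⊆U))
    where
    ∩-monoˡ : ∀ {k} {P Q R : Subset k} → P ⊆ Q → P ∩ R ⊆ Q ∩ R
    ∩-monoˡ {P = P} P⊆Q x∈ = let (a , b) = x∈p∩q⁻ P _ x∈ in x∈p∩q⁺ (P⊆Q a , b)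

  sparse-⊆ : ∀ {T U X Y} → T ⊆ U → X ⊆ Y → Sparse U Y → Sparse T X
  sparse-⊆ T⊆U X⊆Y sp S = ≤-trans (weight-mono T⊆U X⊆Y) (sp S)

  sum-∩ : ∀ {k} (P : Subset k) {A B C D} →
    (∀ {x} → x ∈ A ⊎ x ∈ B → x ∈ C) → (∀ {x} → x ∈ A → x ∈ B → x ∈ D) →
    ∣ P ∩ A ∣ + ∣ P ∩ B ∣ ≤ ∣ P ∩ C ∣ + ∣ P ∩ D ∣
  sum-∩ P {A} {B} {C} {D} ∪⊆C ∩⊆D = begin
    ∣ P ∩ A ∣ + ∣ P ∩ B ∣                           ≡⟨ ∣∪∣+∣∩∣ (P ∩ A) (P ∩ B) ⟨
    ∣ (P ∩ A) ∪ (P ∩ B) ∣ + ∣ (P ∩ A) ∩ (P ∩ B) ∣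
      ≤⟨ +-mono-≤ (p⊆q⇒∣p∣≤∣q∣ (∪-⊆
           (λ x∈ → let (a , b) = x∈p∩q⁻ P A x∈ in x∈p∩q⁺ (a , ∪⊆C (inj₁ b)))
           (λ x∈ → let (a , b) = x∈p∩q⁻ P B x∈ in x∈p∩q⁺ (a , ∪⊆C (inj₂ b)))))
         (p⊆q⇒∣p∣≤∣q∣ (λ x∈ → let (x∈A , x∈B) = x∈p∩q⁻ (P ∩ A) _ x∈
                                  (a , b) = x∈p∩q⁻ P A x∈A
                              in x∈p∩q⁺ (a , ∩⊆D b (proj₂ (x∈p∩q⁻ P B x∈B))))) ⟩
    ∣ P ∩ C ∣ + ∣ P ∩ D ∣                           ∎
    where open ≤-Reasoning

  -- Edges counted on the left in both terms lie within `A ∩ B`; edges between `A ─ B` and `B ─ A`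
  -- count only on the right.
  weight-supermodular : ∀ T X A B → weight T X A + weight T X B ≤ weight T X (A ∪ B) + weight T X (A ∩ B)
  weight-supermodular T X A B = begin
    weight T X A + weight T X B
      ≡⟨ shuffle ∣ X ∩ within A ∣ _ _ _ ⟩
    (∣ X ∩ within A ∣ + ∣ X ∩ within B ∣) + (∣ T ∩ A ∣ + ∣ T ∩ B ∣)
      ≤⟨ +-mono-≤
           (sum-∩ X [ within-mono (p⊆p∪q B) , within-mono (q⊆p∪q A B) ]′
             (λ a b → let (s , t) = ∈-within⁻ A a ; (s′ , t′) = ∈-within⁻ B b in
               ∈-within⁺ (A ∩ B) (x∈p∩q⁺ (s , s′)) (x∈p∩q⁺ (t , t′))))
           (sum-∩ T {A} {B} x∈p∪q⁺ (λ a b → x∈p∩q⁺ (a , b))) ⟩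
    (∣ X ∩ within (A ∪ B) ∣ + ∣ X ∩ within (A ∩ B) ∣) + (∣ T ∩ (A ∪ B) ∣ + ∣ T ∩ (A ∩ B) ∣)
      ≡⟨ shuffle ∣ X ∩ within (A ∪ B) ∣ _ _ _ ⟩
    weight T X (A ∪ B) + weight T X (A ∩ B)  ∎
    where
    open ≤-Reasoning
    shuffle : ∀ a b c d → (a + b) + (c + d) ≡ (a + c) + (b + d)
    shuffle = solve-∀

  module Tightness (T : Subset m) (X : Subset n) (sparse : Sparse T X) where

    -- Equality, in view of `sparse`.
    Tight : Subset m → Set
    Tight S = ∣ S ∣ ≤ weight T X S

    -- Uncrossing: cardinality is modular, weight is supermodular, and `sparse` bounds the weight of
    -- the intersection.
    tight-∪ : ∀ {A B} → Tight A → Tight B → Tight (A ∪ B)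
    tight-∪ {A} {B} tA tB = +-cancelʳ-≤ ∣ A ∩ B ∣ _ _ (begin
      ∣ A ∪ B ∣ + ∣ A ∩ B ∣                        ≡⟨ ∣∪∣+∣∩∣ A B ⟩
      ∣ A ∣ + ∣ B ∣                                ≤⟨ +-mono-≤ tA tB ⟩
      weight T X A + weight T X B                  ≤⟨ weight-supermodular T X A B ⟩
      weight T X (A ∪ B) + weight T X (A ∩ B)      ≤⟨ +-monoʳ-≤ _ (sparse (A ∩ B)) ⟩
      weight T X (A ∪ B) + ∣ A ∩ B ∣               ∎)
      where open ≤-Reasoning

    -- The empty set is tight, and a tight set that is not contained in `S` can be united with it.
    largest-tight : ∃[ S ] (Tight S × (∀ {A} → Tight A → A ⊆ S))
    largest-tight = go m {∅} (subst (_≤ weight T X ∅) (sym (∣⊥∣≡0 m)) z≤n) (m≤m+n m _)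
      where
      go : ∀ d {S} → Tight S → m ≤ d + ∣ S ∣ → ∃[ S′ ] (Tight S′ × (∀ {A} → Tight A → A ⊆ S′))
      go d {S} tS m≤ with anySubset? (λ A → (∣ A ∣ ≤? weight T X A) ×-dec nonempty? (A ─ S))
      ... | no none = S , tS , (λ {A} tA {x} x∈ → decidable-stable (x ∈? S)
                        (λ x∉ → none (A , tA , x , x∈p∧x∉q⇒x∈p─q x∈ x∉)))
      go zero {S} tS m≤ | yes (A , tA , x , x∈) = ⊥-elim (<⇒≱
        (≤-trans (p⊂q⇒∣p∣<∣q∣ {p = S} ((λ {x} _ → ∈⊤) , x , ∈⊤ , proj₂ (∈-─⁻ A S x∈))) (≤-reflexive (∣⊤∣≡n m))) m≤)
      go (suc d) {S} tS m≤ | yes (A , tA , x , x∈) = go d (tight-∪ tS tA) (begin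
        m                   ≤⟨ m≤ ⟩
        suc d + ∣ S ∣       ≡⟨ +-suc d ∣ S ∣ ⟨
        d + suc ∣ S ∣       ≤⟨ +-monoʳ-≤ d (p⊂q⇒∣p∣<∣q∣
                                 (p⊆p∪q A , x , q⊆p∪q S A (p─q⊆p A S x∈) , proj₂ (∈-─⁻ A S x∈))) ⟩
        d + ∣ S ∪ A ∣       ∎)
        where open ≤-Reasoning

    S₀ : Subset m
    S₀ = proj₁ largest-tight

    S₀-tight : Tight S₀
    S₀-tight = proj₁ (proj₂ largest-tight)

    -- Why the largest tight set is used: every set that reaches outside it has room for one more
    -- joint or edge.
    slack : ∀ {S u} → u ∈ S → u ∉ S₀ → weight T X S < ∣ S ∣
    slack {S} u∈ u∉ = ≰⇒> (λ tS → u∉ (proj₂ (proj₂ largest-tight) tS u∈))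

    sparse-joint : ∀ {u} → u ∉ S₀ → Sparse (T ∪ ⁅ u ⁆) X
    sparse-joint {u} u∉ S with u ∈? S
    ... | yes u∈ = begin
      ∣ X ∩ within S ∣ + ∣ (T ∪ ⁅ u ⁆) ∩ S ∣
        ≤⟨ +-monoʳ-≤ ∣ X ∩ within S ∣ (≤-trans (p⊆q⇒∣p∣≤∣q∣ sub) (insert-card-≤ (T ∩ S) u)) ⟩
      ∣ X ∩ within S ∣ + suc ∣ T ∩ S ∣       ≡⟨ +-suc ∣ X ∩ within S ∣ _ ⟩
      suc (weight T X S)                     ≤⟨ slack u∈ u∉ ⟩
      ∣ S ∣                                  ∎
      where
      open ≤-Reasoning
      sub : (T ∪ ⁅ u ⁆) ∩ S ⊆ (T ∩ S) ∪ ⁅ u ⁆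
      sub x∈ with x∈p∩q⁻ (T ∪ ⁅ u ⁆) S x∈
      ... | x∈T+u , x∈S with ∈-insert⁻ T x∈T+u
      ...   | inj₁ x∈T  = ∈-insertˡ (x∈p∩q⁺ (x∈T , x∈S))
      ...   | inj₂ refl = ∈-insertʳ (T ∩ S) _
    ... | no u∉S = ≤-trans (+-monoʳ-≤ ∣ X ∩ within S ∣ (p⊆q⇒∣p∣≤∣q∣ sub)) (sparse S)
      where
      sub : (T ∪ ⁅ u ⁆) ∩ S ⊆ T ∩ S
      sub x∈ with x∈p∩q⁻ (T ∪ ⁅ u ⁆) S x∈
      ... | x∈T+u , x∈S with ∈-insert⁻ T x∈T+u
      ...   | inj₁ x∈T  = x∈p∩q⁺ (x∈T , x∈S)
      ...   | inj₂ refl = ⊥-elim (u∉S x∈S)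

    outer-end : ∀ {y} → y ∉ within S₀ → ∃[ u ] (u ∉ S₀ × Incident ends y u)
    outer-end {y} y∉ with src y ∈? S₀ | tgt y ∈? S₀
    ... | no s∉ | _ = src y , s∉ , inj₁ refl
    ... | yes _ | no t∉ = tgt y , t∉ , inj₂ refl
    ... | yes s | yes t = ⊥-elim (y∉ (∈-within⁺ S₀ s t))

    sparse-edge : ∀ {y} → y ∉ within S₀ → Sparse T (X ∪ ⁅ y ⁆)
    sparse-edge {y} y∉ S with y ∈? within S
    ... | yes y∈ = begin
      ∣ (X ∪ ⁅ y ⁆) ∩ within S ∣ + ∣ T ∩ S ∣
        ≤⟨ +-monoˡ-≤ ∣ T ∩ S ∣ (≤-trans (p⊆q⇒∣p∣≤∣q∣ sub) (insert-card-≤ (X ∩ within S) y)) ⟩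
      suc (weight T X S)
        ≤⟨ (let (u , u∉ , inc) = outer-end y∉ in slack (within-incident S y∈ inc) u∉) ⟩
      ∣ S ∣                                    ∎
      where
      open ≤-Reasoning
      sub : (X ∪ ⁅ y ⁆) ∩ within S ⊆ (X ∩ within S) ∪ ⁅ y ⁆
      sub x∈ with x∈p∩q⁻ (X ∪ ⁅ y ⁆) _ x∈
      ... | x∈X+y , x∈S with ∈-insert⁻ X x∈X+y
      ...   | inj₁ x∈X  = ∈-insertˡ (x∈p∩q⁺ (x∈X , x∈S))
      ...   | inj₂ refl = ∈-insertʳ (X ∩ within S) _
    ... | no y∉S = ≤-trans (+-monoˡ-≤ ∣ T ∩ S ∣ (p⊆q⇒∣p∣≤∣q∣ sub)) (sparse S)
      where
      sub : (X ∪ ⁅ y ⁆) ∩ within S ⊆ X ∩ within S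
      sub x∈ with x∈p∩q⁻ (X ∪ ⁅ y ⁆) _ x∈
      ... | x∈X+y , x∈S with ∈-insert⁻ X x∈X+y
      ...   | inj₁ x∈X  = x∈p∩q⁺ (x∈X , x∈S)
      ...   | inj₂ refl = ⊥-elim (y∉S x∈S)

    -- An edge of `X` from `S₀` to an outside vertex `b` would pay for `b` and make the larger set
    -- tight.
    S₀-closed : Closed X S₀
    S₀-closed {x} {a} {b} x∈ j a∈ = decidable-stable (b ∈? S₀) (λ b∉ →
      <⇒≱ (slack (∈-insertʳ S₀ b) b∉) (begin
      ∣ S₀ ∪ ⁅ b ⁆ ∣                 ≡⟨ insert-card S₀ b∉ ⟩
      suc ∣ S₀ ∣                     ≤⟨ s≤s S₀-tight ⟩
      suc (weight T X S₀)
        ≡⟨ cong (_+ ∣ T ∩ S₀ ∣) (insert-card (X ∩ within S₀)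
             (λ x∈′ → b∉ (proj₂ (joins-within⁻ S₀ j (proj₂ (x∈p∩q⁻ X _ x∈′)))))) ⟨
      ∣ (X ∩ within S₀) ∪ ⁅ x ⁆ ∣ + ∣ T ∩ S₀ ∣
        ≤⟨ +-mono-≤
             (p⊆q⇒∣p∣≤∣q∣ (insert-⊆
               (λ y∈ → let (p , q) = x∈p∩q⁻ X _ y∈ in x∈p∩q⁺ (p , within-mono ∈-insertˡ q))
               (x∈p∩q⁺ (x∈ , joins-within⁺ (S₀ ∪ ⁅ b ⁆) j (∈-insertˡ a∈) (∈-insertʳ S₀ b)))))
             (p⊆q⇒∣p∣≤∣q∣ {p = T ∩ S₀} {T ∩ (S₀ ∪ ⁅ b ⁆)}
               (λ y∈ → let (p , q) = x∈p∩q⁻ T S₀ y∈ in x∈p∩q⁺ (p , ∈-insertˡ q))) ⟩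
      weight T X (S₀ ∪ ⁅ b ⁆)        ∎))
      where open ≤-Reasoning

    -- Growing from S₀ through y reaches a set of vertices that is not tight, so the
    -- edges of X available there are too few to make X + y dependent.
    indep-crossing : ∀ {y a b} → Indep M X → Joins ends y a b → a ∈ S₀ → b ∉ S₀ → Indep M (X ∪ ⁅ y ⁆)
    indep-crossing {y} {a} {b} indX j a∈ b∉ = rank⇒indep (+-cancelʳ-≤ ∣ S₀ ∣ _ _ (begin
      ∣ Z ∣ + ∣ S₀ ∣                           ≤⟨ +-monoˡ-≤ ∣ S₀ ∣ (insert-card-≤ X y) ⟩
      suc ∣ X ∣ + ∣ S₀ ∣                       ≤⟨ +-monoˡ-≤ ∣ S₀ ∣ (s≤s (cover-card cover)) ⟩
      suc (∣ W ∣ + ∣ X ∩ within D ∣) + ∣ S₀ ∣  ≡⟨ cong (_+ ∣ S₀ ∣) (+-suc ∣ W ∣ _) ⟨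
      (∣ W ∣ + suc ∣ X ∩ within D ∣) + ∣ S₀ ∣
        ≤⟨ +-monoˡ-≤ ∣ S₀ ∣ (+-monoʳ-≤ ∣ W ∣ (≤-trans (s≤s (m≤m+n _ _)) (slack b∈D b∉))) ⟩
      (∣ W ∣ + ∣ D ∣) + ∣ S₀ ∣                 ≡⟨ +-assoc ∣ W ∣ _ _ ⟩
      ∣ W ∣ + (∣ D ∣ + ∣ S₀ ∣)                 ≤⟨ +-monoʳ-≤ ∣ W ∣ (disjoint-card (p─q⊆p hull S₀) ⊇-start
                                                    (λ x∈ → proj₂ (∈-─⁻ hull S₀ x∈))) ⟩
      ∣ W ∣ + ∣ hull ∣                         ≡⟨ cong (_+ ∣ hull ∣) (indep⇒rank (indep-⊆ M (p∩q⊆p X _) indX)) ⟨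
      r W + ∣ hull ∣                           ≤⟨ grow-rank grow away (∈-insertˡ ∘ p∩q⊆p X _) (λ e∈ _ → e∈) ⟩
      r Z + ∣ S₀ ∣                             ∎))
      where
      open ≤-Reasoning
      Z = X ∪ ⁅ y ⁆
      open Closure (closure Z {Full} {S₀} ⊆⊤)
      D = hull ─ S₀
      -- `D` is closed under `X`, so `X` splits into `W` and fewer than |D| edges within `D`, while
      -- the growth through `D` raises the rank of `W` by |D|.
      W = X ∩ within (∁ D)
      b∈D : b ∈ D
      b∈D = x∈p∧x∉q⇒x∈p─q (closed (∈-insertʳ X y) j (⊇-start a∈) ∈⊤) b∉
      away : ∀ {e u} → e ∈ W → Incident ends e u → u ∈ hull → u ∈ S₀
      away {u = u} e∈ inc u∈ = decidable-stable (u ∈? S₀) (λ u∉ →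
        x∈∁p⇒x∉p (within-incident (∁ D) (proj₂ (x∈p∩q⁻ X _ e∈)) inc) (x∈p∧x∉q⇒x∈p─q u∈ u∉))
      D-closed : Closed X D
      D-closed e∈ j′ u∈ with ∈-─⁻ hull S₀ u∈
      ... | u∈hull , u∉S₀ = x∈p∧x∉q⇒x∈p─q (closed (∈-insertˡ e∈) j′ u∈hull ∈⊤)
                              (λ w∈ → u∉S₀ (S₀-closed e∈ (joins-sym j′) w∈))
      cover : ∀ {x} → x ∈ X → x ∈ W ⊎ x ∈ X ∩ within D
      cover {x} x∈ with src x ∈? D
      ... | yes s∈ = inj₂ (x∈p∩q⁺ (x∈ , ∈-within⁺ D s∈ (D-closed x∈ (joins-ends x) s∈)))
      ... | no s∉ = inj₁ (x∈p∩q⁺ (x∈ , ∈-within⁺ (∁ D) (x∉p⇒x∈∁p s∉)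
                      (closed-∁ {S = D} D-closed x∈ (joins-ends x) (x∉p⇒x∈∁p s∉))))

    -- An edge with one end in `S₀` is covered by `indep-crossing`. If both ends are outside, then
    -- `X` splits along the closed set `S₀`, and `direct` joins the inner part to the outer part
    -- with `y`.
    indep-edge : ∀ {y} → Indep M X → y ∉ within S₀ → Indep M ((X ─ within S₀) ∪ ⁅ y ⁆) → Indep M (X ∪ ⁅ y ⁆)
    indep-edge {y} indX y∉ ind with src y ∈? S₀ | tgt y ∈? S₀
    ... | yes s∈ | yes t∈ = ⊥-elim (y∉ (∈-within⁺ S₀ s∈ t∈))
    ... | yes s∈ | no t∉ = indep-crossing indX (joins-ends y) s∈ t∉
    ... | no s∉ | yes t∈ = indep-crossing indX (joins-sym (joins-ends y)) t∈ s∉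
    ... | no s∉ | no t∉ = indep-⊆ M (insert-⊆ split (q⊆p∪q _ Y (∈-insertʳ (X ─ within S₀) y)))
        (direct S₀ {X ∩ within S₀} {Y} (p∩q⊆q X _) (insert-⊆ outer (∈-within⁺ (∁ S₀) (x∉p⇒x∈∁p s∉) (x∉p⇒x∈∁p t∉)))
          (indep-⊆ M (p∩q⊆p X _) indX) ind)
      where
      Y = (X ─ within S₀) ∪ ⁅ y ⁆
      split : X ⊆ (X ∩ within S₀) ∪ Y
      split {x} x∈ with x ∈? within S₀
      ... | yes x∈S₀ = x∈p∪q⁺ (inj₁ (x∈p∩q⁺ (x∈ , x∈S₀)))
      ... | no x∉S₀ = q⊆p∪q (X ∩ within S₀) Y (∈-insertˡ (x∈p∧x∉q⇒x∈p─q x∈ x∉S₀))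
      outer : X ─ within S₀ ⊆ within (∁ S₀)
      outer {x} x∈ with ∈-─⁻ X (within S₀) x∈
      ... | x∈X , x∉ = ∈-within⁺ (∁ S₀) s∈ (closed-∁ {S = S₀} S₀-closed x∈X (joins-ends x) s∈)
        where
        s∈ : src x ∈ ∁ S₀
        s∈ = x∉p⇒x∈∁p (λ s → x∉ (∈-within⁺ S₀ s (S₀-closed x∈X (joins-ends x) s)))

  IndepJ : Subset (m + n) → Set
  IndepJ Z = Indep M (drop m Z) × Sparse (take m Z) (drop m Z)

  split-card : ∀ {k} (P A : Subset k) → ∣ P ∣ ≤ ∣ P ∩ A ∣ + ∣ P ─ A ∣
  split-card P A = cover-card cover
    where
    cover : ∀ {x} → x ∈ P → x ∈ P ∩ A ⊎ x ∈ P ─ A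
    cover {x} x∈ with x ∈? A
    ... | yes x∈A = inj₁ (x∈p∩q⁺ (x∈ , x∈A))
    ... | no x∉A = inj₂ (x∈p∧x∉q⇒x∈p─q x∈ x∉A)

  split-card′ : ∀ {k} (P A : Subset k) → ∣ P ∩ A ∣ + ∣ P ─ A ∣ ≤ ∣ P ∣
  split-card′ P A = disjoint-card (p∩q⊆p P A) (p─q⊆p P A)
    (λ x∈ x∈′ → proj₂ (∈-─⁻ P A x∈′) (proj₂ (x∈p∩q⁻ P A x∈)))

  -- Tightness of `S₀` for `I` means that `J` has no surplus there. So `J` has more joints outside
  -- `S₀`, and any new one will do, or more edges not within `S₀`, and augmentation in `M` picks
  -- one.
  augmentJ : ∀ I J → IndepJ I → IndepJ J → ∣ I ∣ < ∣ J ∣ → ∃[ x ] (x ∈ J × x ∉ I × IndepJ (I ∪ ⁅ x ⁆))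
  augmentJ I J (indX , spX) (indY , spY) I<J with ∣ T ─ S₀ ∣ <? ∣ U ─ S₀ ∣ | ∣ X ─ within S₀ ∣ <? ∣ Y ─ within S₀ ∣
    where
    T = take m I
    X = drop m I
    U = take m J
    Y = drop m J
    open Tightness T X spX
  ... | yes lt | _ with pigeonhole lt
  ...   | u , u∈ , u∉ = u ↑ˡ n , ∈-take⁻ m J u∈U , (λ u∈I → u∉ (x∈p∧x∉q⇒x∈p─q (∈-take⁺ m I u∈I) u∉S₀)) ,
    indep-⊆ M (drop-insertˡ I u) indX , sparse-⊆ (take-insertˡ I u) (drop-insertˡ I u) (sparse-joint u∉S₀)
    where
    open Tightness (take m I) (drop m I) spX
    u∈U = proj₁ (∈-─⁻ (take m J) S₀ u∈)
    u∉S₀ = proj₂ (∈-─⁻ (take m J) S₀ u∈)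
  augmentJ I J (indX , spX) (indY , spY) I<J | no _ | yes lt
    with indep-aug M (indep-⊆ M (p─q⊆p (drop m I) _) indX) (indep-⊆ M (p─q⊆p (drop m J) _) indY) lt
  ... | y , y∈ , y∉ , ind = m ↑ʳ y , ∈-drop⁻ m J y∈Y ,
    (λ y∈I → y∉ (x∈p∧x∉q⇒x∈p─q (∈-drop⁺ m I y∈I) y∉S₀)) ,
    indep-⊆ M (drop-insertʳ I y) (indep-edge indX y∉S₀ ind) ,
    sparse-⊆ (take-insertʳ I y) (drop-insertʳ I y) (sparse-edge y∉S₀)
    where
    open Tightness (take m I) (drop m I) spX
    y∈Y = proj₁ (∈-─⁻ (drop m J) (within S₀) y∈)
    y∉S₀ = proj₂ (∈-─⁻ (drop m J) (within S₀) y∈)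
  augmentJ I J (indX , spX) (indY , spY) I<J | no T≮U | no X≮Y = ⊥-elim (<⇒≱ I<J (begin
    ∣ J ∣                                                         ≡⟨ card-take-drop m J ⟩
    ∣ U ∣ + ∣ Y ∣                                                 ≤⟨ +-mono-≤ (split-card U S₀) (split-card Y _) ⟩
    (∣ U ∩ S₀ ∣ + ∣ U ─ S₀ ∣) + (∣ Y ∩ within S₀ ∣ + ∣ Y ─ within S₀ ∣)
      ≤⟨ +-mono-≤ (+-monoʳ-≤ ∣ U ∩ S₀ ∣ (≮⇒≥ T≮U)) (+-monoʳ-≤ ∣ Y ∩ within S₀ ∣ (≮⇒≥ X≮Y)) ⟩
    (∣ U ∩ S₀ ∣ + t) + (∣ Y ∩ within S₀ ∣ + x)                    ≡⟨ gather ∣ U ∩ S₀ ∣ t _ x ⟩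
    weight U Y S₀ + (t + x)                                       ≤⟨ +-monoˡ-≤ (t + x) (≤-trans (spY S₀) S₀-tight) ⟩
    weight T X S₀ + (t + x)                                       ≡⟨ gather ∣ T ∩ S₀ ∣ t _ x ⟨
    (∣ T ∩ S₀ ∣ + t) + (∣ X ∩ within S₀ ∣ + x)                    ≤⟨ +-mono-≤ (split-card′ T S₀) (split-card′ X _) ⟩
    ∣ T ∣ + ∣ X ∣                                                 ≡⟨ card-take-drop m I ⟨
    ∣ I ∣                                                         ∎))
    where
    open ≤-Reasoning
    T = take m I
    X = drop m I
    U = take m J
    Y = drop m J
    open Tightness T X spX
    t = ∣ T ─ S₀ ∣
    x = ∣ X ─ within S₀ ∣
    gather : ∀ a b c d → (a + b) + (c + d) ≡ (c + a) + (b + d)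
    gather = solve-∀

  jointed : Matroid (m + n)
  jointed = record
    { Indep     = IndepJ
    ; Indep?    = λ Z → Indep? M (drop m Z) ×-dec sparse? (take m Z) (drop m Z)
    ; indep-∅   = indep-⊆ M (λ x∈ → ⊥-elim (∉⊥ (∈-drop⁻ m ∅ x∈))) (indep-∅ M) ,
                  λ S → ≤-trans (≤-reflexive (cong₂ _+_
                    (∅-card (λ x∈ → ∉⊥ (∈-drop⁻ m ∅ (proj₁ (x∈p∩q⁻ (drop m ∅) _ x∈)))))
                    (∅-card (λ x∈ → ∉⊥ (∈-take⁻ m ∅ (proj₁ (x∈p∩q⁻ (take m ∅) _ x∈))))))) z≤n
    ; indep-⊆   = λ {I} {J} J⊆I (ind , sp) →
        let drop⊆ : drop m J ⊆ drop m I
            drop⊆ x∈ = ∈-drop⁺ m I (J⊆I (∈-drop⁻ m J x∈))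
            take⊆ : take m J ⊆ take m I
            take⊆ x∈ = ∈-take⁺ m I (J⊆I (∈-take⁻ m J x∈))
        in indep-⊆ M drop⊆ ind , sparse-⊆ take⊆ drop⊆ sp
    ; indep-aug = λ {I} {J} → augmentJ I J
    }

  module RJ = Rank jointed

  IndepJ-intro : ∀ T X → Indep M X → Sparse T X → IndepJ (T ++ X)
  IndepJ-intro T X ind sp rewrite take-++ T X | drop-++ T X = ind , sp

  joints-indep : ∀ S → IndepJ (S ++ ∅)
  joints-indep S = IndepJ-intro S ∅ (indep-∅ M) (λ A → begin
    ∣ ∅ ∩ within A ∣ + ∣ S ∩ A ∣
      ≡⟨ cong (_+ ∣ S ∩ A ∣) (∅-card (λ x∈ → ∉⊥ (proj₁ (x∈p∩q⁻ ∅ (within A) x∈)))) ⟩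
    ∣ S ∩ A ∣                       ≤⟨ ∣p∩q∣≤∣q∣ S A ⟩
    ∣ A ∣                           ∎)
    where open ≤-Reasoning

  card-++∅ : ∀ (S : Subset m) → ∣ S ++ ∅ {n} ∣ ≡ ∣ S ∣
  card-++∅ S = trans (card-take-drop m (S ++ ∅)) (trans
    (cong₂ _+_ (cong ∣_∣ (take-++ S ∅)) (trans (cong ∣_∣ (drop-++ S ∅)) (∣⊥∣≡0 n))) (+-identityʳ _))

  card-within : ∀ {S Z} → IndepJ Z → take m Z ⊆ S → drop m Z ⊆ within S → ∣ Z ∣ ≤ ∣ S ∣
  card-within {S} {Z} (_ , sp) T⊆S X⊆S = begin
    ∣ Z ∣                             ≡⟨ card-take-drop m Z ⟩
    ∣ take m Z ∣ + ∣ drop m Z ∣       ≡⟨ +-comm ∣ take m Z ∣ _ ⟩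
    ∣ drop m Z ∣ + ∣ take m Z ∣       ≤⟨ +-mono-≤ (p⊆q⇒∣p∣≤∣q∣ (λ x∈ → x∈p∩q⁺ (x∈ , X⊆S x∈)))
                                                  (p⊆q⇒∣p∣≤∣q∣ (λ x∈ → x∈p∩q⁺ (x∈ , T⊆S x∈))) ⟩
    weight (take m Z) (drop m Z) S    ≤⟨ sp S ⟩
    ∣ S ∣                             ∎
    where open ≤-Reasoning

  -- Sparsity at the full vertex set allows at most `m` elements, which the joints already use up.
  joints-basis : IsBasis jointed (Full {m} ++ ∅ {n})
  joints-basis = joints-indep Full , λ x x∉ ind → <⇒≱
    (≤-reflexive (sym (trans (insert-card (Full {m} ++ ∅ {n}) x∉) (cong suc (card-++∅ Full)))))
    (card-within ind (λ _ → ∈⊤) (λ _ → ∈-within⁺ Full ∈⊤ ∈⊤))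

  -- An edge is spanned by the joints at its ends: sparsity at this set of ends allows no more
  -- elements than there are ends.
  spanned-by-two : ∀ x → ∃[ S ] (∣ S ∣ ≤ 2 × InCl jointed (S ++ ∅ {n}) x)
  spanned-by-two x with splitAt m x in eq
  ... | inj₁ v = ⁅ v ⁆ , ≤-trans (≤-reflexive (∣⁅x⁆∣≡1 v)) (s≤s z≤n) ,
    ≤-antisym (RJ.rank-mono (insert-⊆ ⊆-refl x∈)) (RJ.rank-mono (p⊆p∪q ⁅ x ⁆))
    where
    x∈ : x ∈ ⁅ v ⁆ ++ ∅ {n}
    x∈ = subst (_∈ ⁅ v ⁆ ++ ∅ {n}) (Fin.splitAt⁻¹-↑ˡ eq)
           (∈-take⁻ m (⁅ v ⁆ ++ ∅) (subst (v ∈_) (sym (take-++ ⁅ v ⁆ ∅)) (x∈⁅x⁆ v)))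
  ... | inj₂ f with refl ← Fin.splitAt⁻¹-↑ʳ {m} {n} eq =
    S , ≤-trans (insert-card-≤ ⁅ src f ⁆ (tgt f)) (≤-reflexive (cong suc (∣⁅x⁆∣≡1 (src f)))) ,
    ≤-antisym (RJ.rank-≤ bound) (RJ.rank-mono (p⊆p∪q ⁅ m ↑ʳ f ⁆))
    where
    S = ⁅ src f ⁆ ∪ ⁅ tgt f ⁆
    bound : ∀ {I} → I ⊆ (S ++ ∅) ∪ ⁅ m ↑ʳ f ⁆ → IndepJ I → ∣ I ∣ ≤ RJ.r (S ++ ∅ {n})
    bound {I} I⊆ ind = begin
      ∣ I ∣                 ≤⟨ card-within ind joints edges ⟩
      ∣ S ∣                 ≡⟨ card-++∅ S ⟨
      ∣ S ++ ∅ {n} ∣        ≤⟨ RJ.indep⇒≤rank ⊆-refl (joints-indep S) ⟩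
      RJ.r (S ++ ∅)         ∎
      where
      open ≤-Reasoning
      joints : take m I ⊆ S
      joints u∈ = subst (_ ∈_) (take-++ S ∅)
        (take-insertʳ (S ++ ∅) f (∈-take⁺ m _ (I⊆ (∈-take⁻ m I u∈))))
      edges : drop m I ⊆ within S
      edges y∈ with ∈-insert⁻ (drop m (S ++ ∅)) (drop-insertʳ (S ++ ∅) f (∈-drop⁺ m _ (I⊆ (∈-drop⁻ m I y∈))))
      ... | inj₁ y∈∅ = ⊥-elim (∉⊥ (subst (_ ∈_) (drop-++ S ∅) y∈∅))
      ... | inj₂ refl = ∈-within⁺ S (∈-insertˡ (x∈⁅x⁆ _)) (∈-insertʳ ⁅ src f ⁆ _)

  -- Without joints, sparsity of an independent set is the bound `rank-within`, so deleting the
  -- joints gives back `M`.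
  frame : IsFrame M
  frame = m , jointed , joints-basis , spanned-by-two ,
    λ X → (λ ind → IndepJ-intro ∅ X ind (λ S → begin
        ∣ X ∩ within S ∣ + ∣ ∅ ∩ S ∣
          ≡⟨ cong (∣ X ∩ within S ∣ +_) (∅-card (λ x∈ → ∉⊥ (proj₁ (x∈p∩q⁻ ∅ S x∈)))) ⟩
        ∣ X ∩ within S ∣ + 0      ≡⟨ +-identityʳ _ ⟩
        ∣ X ∩ within S ∣          ≤⟨ indep⇒≤rank (p∩q⊆q X _) (indep-⊆ M (p∩q⊆p X _) ind) ⟩
        r (within S)              ≤⟨ rank-within S ⟩
        ∣ S ∣                     ∎)) ,
      λ (ind , _) → subst (Indep M) (drop-++ (∅ {m}) X) ind
    where open ≤-Reasoning

-- Consequences of 3-connectivity.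

module Separations {n m : ℕ} (M : Matroid n) (ends : Ends n m) (F : IsFramework M ends)
  (conn3 : ThreeConnected M) where
  open Rank M
  open Graph ends
  open IsFramework F
  open Framework M ends F

  no-1-separation : ∀ {X x y} → x ∈ X → y ∉ X → ¬ r X + r (∁ X) ≤ r Full
  no-1-separation {X} x∈ y∉ le = <⇒≱ (≤-trans (≤-reflexive (+-comm 1 (r Full)))
    (conn3 1 ≤-refl (s≤s (s≤s z≤n)) X (nonempty-card x∈) (nonempty-card (x∉p⇒x∈∁p y∉)))) le

  no-2-separation : ∀ {X} → 2 ≤ ∣ X ∣ → 2 ≤ ∣ ∁ X ∣ → ¬ r X + r (∁ X) ≤ suc (r Full)
  no-2-separation {X} 2≤X 2≤∁X le = <⇒≱ (≤-trans (≤-reflexive (+-comm 2 (r Full)))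
    (conn3 2 (s≤s z≤n) ≤-refl X 2≤X 2≤∁X)) le

  -- An element of rank 0 forms a 1-separation with any nonempty remainder.
  dependent-only : ∀ {e x} → ¬ Indep M ⁅ e ⁆ → x ≡ e
  dependent-only {e} {x} dep = decidable-stable (x ≟ᶠ e) (λ x≢e →
    no-1-separation (x∈⁅x⁆ e) (x≢y⇒x∉⁅y⁆ x≢e) (begin
      r ⁅ e ⁆ + r (∁ ⁅ e ⁆)
        ≤⟨ +-monoˡ-≤ _ (≤-pred (≰⇒> (λ le → dep (rank⇒indep (subst (_≤ r ⁅ e ⁆) (sym (∣⁅x⁆∣≡1 e)) le))))) ⟩
      r (∁ ⁅ e ⁆)               ≤⟨ rank-mono ⊆⊤ ⟩
      r Full                    ∎))
    where open ≤-Reasoning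

  -- A coloop would form a 1-separation.
  spanned-by-rest : ∀ {e x} → x ≢ e → InCl M (∁ ⁅ e ⁆) e
  spanned-by-rest {e} {x} x≢e = decidable-stable (_ ≟ _) (λ e∉cl →
    no-1-separation (x∈⁅x⁆ e) (x≢y⇒x∉⁅y⁆ x≢e) (begin
      r ⁅ e ⁆ + r (∁ ⁅ e ⁆)       ≤⟨ +-monoˡ-≤ _ (rank-⁅⁆≤1 e) ⟩
      suc (r (∁ ⁅ e ⁆))           ≤⟨ rank-insert ⊆-refl e∉cl ⟩
      r (∁ ⁅ e ⁆ ∪ ⁅ e ⁆)         ≤⟨ rank-mono ⊆⊤ ⟩
      r Full                      ∎))
    where open ≤-Reasoning

  module Component (a : Fin m) where
    open Closure (component a) public renaming (hull to H)

    a∈H : a ∈ H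
    a∈H = ⊇-start (x∈⁅x⁆ a)

    H-closed : Closed Full H
    H-closed e∈ j u∈ = closed e∈ j u∈ ∈⊤

    incident⇒within : ∀ {f u} → Incident ends f u → u ∈ H → f ∈ within H
    incident⇒within (inj₁ refl) u∈ = ∈-within⁺ H u∈ (H-closed ∈⊤ (joins-ends _) u∈)
    incident⇒within (inj₂ refl) u∈ = ∈-within⁺ H (H-closed ∈⊤ (joins-sym (joins-ends _)) u∈) u∈

    -- Condition (2) bounds the rank of the component by |H|. Growing from `a` to `H` on top of the
    -- remaining edges adds |H| - 1 to their rank.
    separation : r (within H) + r (∁ (within H)) ≤ suc (r Full)
    separation = begin
      r (within H) + r (∁ (within H))     ≤⟨ +-monoˡ-≤ _ (component-rank a) ⟩
      ∣ H ∣ + r (∁ (within H))            ≡⟨ +-comm ∣ H ∣ _ ⟩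
      r (∁ (within H)) + ∣ H ∣
        ≤⟨ grow-rank grow (λ f∈ inc u∈ → ⊥-elim (x∈∁p⇒x∉p f∈ (incident⇒within inc u∈))) ⊆⊤ (λ _ _ → ∈⊤) ⟩
      r Full + ∣ ⁅ a ⁆ ∣                  ≡⟨ cong (r Full +_) (∣⁅x⁆∣≡1 a) ⟩
      r Full + 1                          ≡⟨ +-comm (r Full) 1 ⟩
      suc (r Full)                        ∎
      where open ≤-Reasoning

  vertexOf? : ∀ X → Decidable (VertexOf ends X)
  vertexOf? X u = Fin.any? (λ e → (e ∈? X) ×-dec incident? e u)

  vertices : Subset n → Subset m
  vertices X = select (vertexOf? X)

  module AtLoop (e : Fin n) (e-loop : proj₁ (ends e) ≡ proj₂ (ends e)) where

    v : Fin m
    v = src e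

    incident-loop : ∀ {u} → Incident ends e u → u ≡ v
    incident-loop (inj₁ refl) = refl
    incident-loop (inj₂ refl) = sym e-loop

    -- Skewness when the loop-edge is not spanned by the edges avoiding its vertex.

    module NotSpanned (e∉cl : ¬ InCl M (edgesAvoiding ends v) e)
      (connected : ∀ f → src f ∈ Closure.hull (component v)) where

      -- On top of `C₂`, the loop-edge raises the rank once at `v` and every further vertex of `K`
      -- raises it once more, so `R` has rank at least |C₂| + |K|. Submodularity with the bound |K|
      -- for `within K` then leaves no dependency between `C₁` and `C₂`.
      indep-∪ : ∀ {C₁ C₂ K} → Grow Full ⁅ v ⁆ K → Indep M C₁ → Indep M C₂ → C₁ ⊆ within K →
                (∀ {f u} → f ∈ C₂ → Incident ends f u → u ∉ K) → Indep M (C₁ ∪ C₂)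
      indep-∪ {C₁} {C₂} {K} g ind₁ ind₂ C₁⊆ C₂∌ = rank⇒indep (+-cancelˡ-≤ ∣ K ∣ _ _ (begin
        ∣ K ∣ + ∣ C₁ ∪ C₂ ∣                ≤⟨ +-monoʳ-≤ ∣ K ∣ (cover-card (x∈p∪q⁻ C₁ C₂)) ⟩
        ∣ K ∣ + (∣ C₁ ∣ + ∣ C₂ ∣)          ≡⟨ rotate (∣ K ∣) (∣ C₁ ∣) (∣ C₂ ∣) ⟩
        (∣ C₂ ∣ + ∣ K ∣) + ∣ C₁ ∣          ≤⟨ +-monoˡ-≤ ∣ C₁ ∣ (≤-pred lower) ⟩
        r R + ∣ C₁ ∣                       ≡⟨ cong (r R +_) (indep⇒rank ind₁) ⟨
        r R + r C₁                         ≤⟨ submodular C₁⊆ (p⊆p∪q C₂) split ⟩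
        r (within K) + r (C₁ ∪ C₂)         ≤⟨ +-monoˡ-≤ _ (rank-within K) ⟩
        ∣ K ∣ + r (C₁ ∪ C₂)                ∎))
        where
        open ≤-Reasoning
        R = C₂ ∪ within K
        v∈K : v ∈ K
        v∈K = grow-⊇ g (x∈⁅x⁆ v)
        rotate : ∀ a b c → a + (b + c) ≡ (c + a) + b
        rotate = solve-∀
        split : ∀ {f} → f ∈ R → f ∈ within K ⊎ f ∈ C₁ ∪ C₂
        split f∈ with x∈p∪q⁻ C₂ (within K) f∈
        ... | inj₁ f∈C₂ = inj₂ (q⊆p∪q C₁ C₂ f∈C₂)
        ... | inj₂ f∈K = inj₁ f∈K
        away : ∀ {f u} → f ∈ C₂ ∪ ⁅ e ⁆ → Incident ends f u → u ∈ K → u ∈ ⁅ v ⁆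
        away f∈ inc u∈ with ∈-insert⁻ C₂ f∈
        ... | inj₁ f∈C₂ = ⊥-elim (C₂∌ f∈C₂ inc u∈)
        ... | inj₂ refl = subst (_∈ ⁅ v ⁆) (sym (incident-loop inc)) (x∈⁅x⁆ v)
        lower : suc (∣ C₂ ∣ + ∣ K ∣) ≤ suc (r R)
        lower = begin
          suc (∣ C₂ ∣ + ∣ K ∣)        ≡⟨ cong (λ c → suc c + ∣ K ∣) (indep⇒rank ind₂) ⟨
          suc (r C₂) + ∣ K ∣
            ≤⟨ +-monoˡ-≤ ∣ K ∣ (rank-insert (λ f∈ → ∈-avoiding⁺ v (λ inc → C₂∌ f∈ inc v∈K)) e∉cl) ⟩
          r (C₂ ∪ ⁅ e ⁆) + ∣ K ∣
            ≤⟨ grow-rank g away (insert-⊆ (p⊆p∪q (within K))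
                 (q⊆p∪q C₂ _ (∈-within⁺ K v∈K (subst (_∈ K) e-loop v∈K)))) (λ _ f∈ → q⊆p∪q C₂ _ f∈) ⟩
          r R + ∣ ⁅ v ⁆ ∣             ≡⟨ cong (r R +_) (∣⁅x⁆∣≡1 v) ⟩
          r R + 1                     ≡⟨ +-comm (r R) 1 ⟩
          suc (r R)                   ∎

      -- A counterexample to skewness, to be refuted. Both sides play the same part, so arguments
      -- about one transfer by `swap`.
      record SplitCircuit (C C₁ C₂ : Subset n) (A₁ A₂ : Subset m) : Set where
        field
          circuit : Circuit M C
          cover   : C ⊆ C₁ ∪ C₂
          C₁⊆C    : C₁ ⊆ C
          C₂⊆C    : C₂ ⊆ C
          ind₁    : Indep M C₁
          ind₂    : Indep M C₂
          C₁⊆A₁   : C₁ ⊆ within A₁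
          C₂⊆A₂   : C₂ ⊆ within A₂
          apart   : ∀ {x} → x ∈ A₁ → x ∉ A₂

        disjoint-vertices : ∀ {u} → u ∈ vertices C₁ → u ∉ vertices C₂
        disjoint-vertices u∈₁ u∈₂ with ∈-select⁻ (vertexOf? C₁) u∈₁ | ∈-select⁻ (vertexOf? C₂) u∈₂
        ... | f , f∈ , inc | g , g∈ , inc′ =
          apart (within-incident A₁ (C₁⊆A₁ f∈) inc) (within-incident A₂ (C₂⊆A₂ g∈) inc′)

        nonempty₂ : ∃[ f ] (f ∈ C₂)
        nonempty₂ with nonempty? C₂
        ... | yes ne = ne
        ... | no empty = ⊥-elim (proj₁ circuit (indep-⊆ M
          (λ f∈ → [ id , (λ f∈₂ → ⊥-elim (empty (_ , f∈₂))) ]′ (x∈p∪q⁻ C₁ C₂ (cover f∈))) ind₁))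

      swap : ∀ {C C₁ C₂ A₁ A₂} → SplitCircuit C C₁ C₂ A₁ A₂ → SplitCircuit C C₂ C₁ A₂ A₁
      swap {C₁ = C₁} {C₂} sc = record
        { circuit = circuit
        ; cover = λ f∈ → [ (λ f∈₁ → q⊆p∪q C₂ C₁ f∈₁) , (λ f∈₂ → p⊆p∪q C₁ f∈₂) ]′ (x∈p∪q⁻ C₁ C₂ (cover f∈))
        ; C₁⊆C = C₂⊆C ; C₂⊆C = C₁⊆C ; ind₁ = ind₂ ; ind₂ = ind₁
        ; C₁⊆A₁ = C₂⊆A₂ ; C₂⊆A₂ = C₁⊆A₁ ; apart = λ x∈₂ x∈₁ → apart x∈₁ x∈₂ }
        where open SplitCircuit sc

      AvoidingHull : Subset n → Set
      AvoidingHull C = Closure Full (∁ (vertices C)) ⁅ v ⁆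

      avoiding-hull : ∀ C → v ∉ vertices C → AvoidingHull C
      avoiding-hull C v∉ = closure Full (⁅⁆-⊆ (x∉p⇒x∈∁p v∉))

      -- A hull of v that avoids C₂ and meets C₁ contains C₁, as C has at most two components.
      no-hull : ∀ {C C₁ C₂ A₁ A₂ u} → SplitCircuit C C₁ C₂ A₁ A₂ → (K : AvoidingHull C₂) →
                u ∈ Closure.hull K → u ∈ vertices C₁ → ⊥
      no-hull {C} {C₁} {C₂} {A₁} {A₂} {u₁} sc K u₁∈K u₁∈ =
        proj₁ circuit (indep-⊆ M cover (indep-∪ grow ind₁ ind₂
          (λ f∈ → ∈-within⁺ hull (reach f∈ (inj₁ refl)) (reach f∈ (inj₂ refl)))
          (λ f∈ inc u∈ → x∈∁p⇒x∉p (inside-W u∈) (∈-select⁺ (vertexOf? C₂) (_ , f∈ , inc)))))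
        where
        open SplitCircuit sc
        open Closure K
        vertex⊆A₁ : ∀ {u} → VertexOf ends C₁ u → u ∈ A₁
        vertex⊆A₁ (f , f∈ , inc) = within-incident A₁ (C₁⊆A₁ f∈) inc
        vertex⊆A₂ : ∀ {u} → VertexOf ends C₂ u → u ∈ A₂
        vertex⊆A₂ (f , f∈ , inc) = within-incident A₂ (C₂⊆A₂ f∈) inc
        A₁-closed : Closed C A₁
        A₁-closed f∈ j u∈ with x∈p∪q⁻ C₁ C₂ (cover f∈)
        ... | inj₁ f∈₁ = proj₂ (joins-within⁻ A₁ j (C₁⊆A₁ f∈₁))
        ... | inj₂ f∈₂ = ⊥-elim (apart u∈ (proj₁ (joins-within⁻ A₂ j (C₂⊆A₂ f∈₂))))
        K-closed : Closed C (hull ∩ A₁)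
        K-closed f∈ j u∈ with x∈p∩q⁻ hull A₁ u∈
        ... | u∈K , u∈A₁ = x∈p∩q⁺ (closed ∈⊤ j u∈K (x∉p⇒x∈∁p
                (λ w∈ → apart w∈A₁ (vertex⊆A₂ (∈-select⁻ (vertexOf? C₂) w∈)))) , w∈A₁)
          where w∈A₁ = A₁-closed f∈ j u∈A₁
        u₁-vertex : VertexOf ends C₁ u₁
        u₁-vertex = ∈-select⁻ (vertexOf? C₁) u₁∈
        widen : ∀ {D u} → D ⊆ C → VertexOf ends D u → VertexOf ends C u
        widen D⊆C (f , f∈ , inc) = f , D⊆C f∈ , inc
        -- Condition (4) is applied to `u₁`, `u` and a vertex of `C₂`. Since `A₁` is closed under
        -- `C`, the last is joined to neither of the others, so `C` joins `u₁` to `u`, and it does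
        -- so inside the hull.
        reach : ∀ {f u} → f ∈ C₁ → Incident ends f u → u ∈ hull
        reach {f} {u} f∈ inc with nonempty₂
        ... | g , g∈ with cond4 C circuit u₁ u (src g) (widen C₁⊆C u₁-vertex)
                            (f , C₁⊆C f∈ , inc) (g , C₂⊆C g∈ , inj₁ refl)
        ... | inj₁ c = proj₁ (x∈p∩q⁻ hull A₁
                (conn-closed {S = hull ∩ A₁} K-closed c (x∈p∩q⁺ (u₁∈K , vertex⊆A₁ u₁-vertex))))
        ... | inj₂ (inj₁ c) = ⊥-elim (apart (conn-closed {S = A₁} A₁-closed c (vertex⊆A₁ u₁-vertex))
                                           (vertex⊆A₂ (g , g∈ , inj₁ refl)))
        ... | inj₂ (inj₂ c) = ⊥-elim (apart (conn-closed {S = A₁} A₁-closed c (vertex⊆A₁ (f , f∈ , inc)))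
                                           (vertex⊆A₂ (g , g∈ , inj₁ refl)))

      -- Some hull of `v` avoids one part and meets the other, as `no-hull` forbids. This is clear
      -- if `v` lies on `C₁` or `C₂`; otherwise both hulls are tried.
      no-split : ∀ {C C₁ C₂ A₁ A₂} → SplitCircuit C C₁ C₂ A₁ A₂ → ⊥
      no-split {C} {C₁} {C₂} sc with v ∈? vertices C₁ | v ∈? vertices C₂
      ... | yes v∈₁ | _ = no-hull sc K (Closure.⊇-start K (x∈⁅x⁆ v)) v∈₁
        where K = avoiding-hull C₂ (SplitCircuit.disjoint-vertices sc v∈₁)
      ... | no v∉₁ | yes v∈₂ = no-hull (swap sc) K (Closure.⊇-start K (x∈⁅x⁆ v)) v∈₂
        where K = avoiding-hull C₁ v∉₁
      ... | no v∉₁ | no v∉₂ with nonempty? (Closure.hull (avoiding-hull C₂ v∉₂) ∩ vertices C₁)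
                             | nonempty? (Closure.hull (avoiding-hull C₁ v∉₁) ∩ vertices C₂)
      ...   | yes (u , u∈) | _ = let (u∈K , u∈₁) = x∈p∩q⁻ _ (vertices C₁) u∈ in
                                 no-hull sc (avoiding-hull C₂ v∉₂) u∈K u∈₁
      ...   | no _ | yes (u , u∈) = let (u∈K , u∈₂) = x∈p∩q⁻ _ (vertices C₂) u∈ in
                                    no-hull (swap sc) (avoiding-hull C₁ v∉₁) u∈K u∈₂
      ...   | no K₂∩C₁ | no K₁∩C₂ = K₂∩C₁ (src f , x∈p∩q⁺ (everything⊆K₂ (connected f) ,
                                      ∈-select⁺ (vertexOf? C₁) (f , f∈ , inj₁ refl)))
        where
        open SplitCircuit sc
        module K₁ = Closure (avoiding-hull C₁ v∉₁)
        module K₂ = Closure (avoiding-hull C₂ v∉₂)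
        f = proj₁ (SplitCircuit.nonempty₂ (swap sc))
        f∈ = proj₂ (SplitCircuit.nonempty₂ (swap sc))
        K₂⊆K₁ : K₂.hull ⊆ K₁.hull
        K₂⊆K₁ = grow-⊆ K₂.grow K₁.⊇-start (λ g∈ j u∈ w∈ →
          K₁.closed g∈ j u∈ (x∉p⇒x∈∁p (λ w∈₁ → K₂∩C₁ (_ , x∈p∩q⁺ (w∈ , w∈₁)))))
        -- If neither hull meets the other part, `K₂` lies in `K₁`, and a step from `K₂` onto `C₂`
        -- would take `K₁` there as well. So `K₂` is the whole component, which contains `C₁`.
        K₂-closed : Closed Full K₂.hull
        K₂-closed {w = w} g∈ j u∈ with w ∈? vertices C₂
        ... | no w∉ = K₂.closed g∈ j u∈ (x∉p⇒x∈∁p w∉)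
        ... | yes w∈ = ⊥-elim (K₁∩C₂ (w , x∈p∩q⁺
                (K₁.closed g∈ j (K₂⊆K₁ u∈) (x∉p⇒x∈∁p (λ w∈₁ → disjoint-vertices w∈₁ w∈)) , w∈)))
        everything⊆K₂ : Closure.hull (component v) ⊆ K₂.hull
        everything⊆K₂ = grow-⊆ (Closure.grow (component v)) K₂.⊇-start (λ g∈ j u∈ _ → K₂-closed g∈ j u∈)

      direct : ∀ A {X Y} → X ⊆ within A → Y ⊆ within (∁ A) → Indep M X → Indep M Y → Indep M (X ∪ Y)
      direct A {X} {Y} X⊆ Y⊆ indX indY = decidable-stable (Indep? M (X ∪ Y)) contra
        where
        contra : ¬ ¬ Indep M (X ∪ Y)
        contra dep with circuit-in dep
        ... | C , C⊆ , circ = no-split {C} {C ∩ X} {C ∩ Y} {A} {∁ A} record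
          { circuit = circ
          ; cover = λ f∈ → [ (λ f∈X → x∈p∪q⁺ (inj₁ (x∈p∩q⁺ (f∈ , f∈X)))) ,
                             (λ f∈Y → q⊆p∪q (C ∩ X) _ (x∈p∩q⁺ (f∈ , f∈Y))) ]′ (x∈p∪q⁻ X Y (C⊆ f∈))
          ; C₁⊆C = p∩q⊆p C X ; C₂⊆C = p∩q⊆p C Y
          ; ind₁ = indep-⊆ M (p∩q⊆q C X) indX ; ind₂ = indep-⊆ M (p∩q⊆q C Y) indY
          ; C₁⊆A₁ = X⊆ ∘ p∩q⊆q C X ; C₂⊆A₂ = Y⊆ ∘ p∩q⊆q C Y
          ; apart = λ x∈ x∈∁ → x∈∁p⇒x∉p x∈∁ x∈ }

    -- The rank bound when the loop-edge is spanned by the edges avoiding its vertex.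

    Bound : Set
    Bound = ∀ {S} → Nonempty S → r (within S ∪ ⁅ e ⁆) ≤ ∣ S ∣

    hull-avoiding-v : ∀ {S} → v ∉ S → Closure Full (∁ ⁅ v ⁆) S
    hull-avoiding-v v∉S = closure Full (λ {u} u∈ → x∉p⇒x∈∁p (λ u∈v → v∉S (subst (_∈ _) (x∈⁅y⁆⇒x≡y v u∈v) u∈)))

    -- The loop-edge does not meet the hull, so it can be carried along while `S` grows in G - v. At
    -- the end it is spanned and `rank-within` applies to the hull.
    spanned-bound : ∀ {S} (v∉S : v ∉ S) → InCl M (within (Closure.hull (hull-avoiding-v v∉S))) e →
                    r (within S ∪ ⁅ e ⁆) ≤ ∣ S ∣
    spanned-bound {S} v∉S e∈cl = +-cancelʳ-≤ ∣ hull ∣ _ _ (begin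
      r (within S ∪ ⁅ e ⁆) + ∣ hull ∣
        ≤⟨ grow-rank grow away (insert-mono (within-mono ⊇-start)) (λ _ f∈ → ∈-insertˡ f∈) ⟩
      r (within hull ∪ ⁅ e ⁆) + ∣ S ∣      ≡⟨ cong (_+ ∣ S ∣) e∈cl ⟩
      r (within hull) + ∣ S ∣              ≤⟨ +-monoˡ-≤ ∣ S ∣ (rank-within hull) ⟩
      ∣ hull ∣ + ∣ S ∣                     ≡⟨ +-comm ∣ hull ∣ ∣ S ∣ ⟩
      ∣ S ∣ + ∣ hull ∣                     ∎)
      where
      open ≤-Reasoning
      open Closure (hull-avoiding-v v∉S)
      away : ∀ {f u} → f ∈ within S ∪ ⁅ e ⁆ → Incident ends f u → u ∈ hull → u ∈ S
      away f∈ inc u∈ with ∈-insert⁻ (within S) f∈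
      ... | inj₁ f∈S = within-incident S f∈S inc
      ... | inj₂ refl = ⊥-elim (x∈∁p⇒x∉p (inside-W u∈)
                          (subst (_∈ ⁅ v ⁆) (sym (incident-loop inc)) (x∈⁅x⁆ v)))

    -- Reduces the bound to sets that miss `v` and contain an edge: if `v` is in `S`, then `e`
    -- already lies within `S`; if no edge lies within `S`, the rank is at most 1.
    bound-with : (∀ {S y} → (v∉S : v ∉ S) → y ∈ within S →
                  InCl M (within (Closure.hull (hull-avoiding-v v∉S))) e) → Bound
    bound-with spans {S} (u , u∈) with v ∈? S | nonempty? (within S)
    ... | yes v∈ | _ = ≤-trans (rank-mono (insert-⊆ ⊆-refl (∈-within⁺ S v∈ (subst (_∈ S) e-loop v∈))))
                         (rank-within S)
    ... | no v∉ | yes (y , y∈) = spanned-bound v∉ (spans v∉ y∈)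
    ... | no v∉ | no empty = ≤-trans (rank-mono {Y = ⁅ e ⁆} (insert-⊆ (λ f∈ → ⊥-elim (empty (_ , f∈))) (x∈⁅x⁆ e)))
                               (≤-trans (rank-⁅⁆≤1 e) (nonempty-card u∈))

    -- Were some edge not at v left out of the hull K of S, then the edges not meeting
    -- K and the remaining ones would form a 2-separation.
    bound-if-spanned : (∀ f → src f ∈ Closure.hull (component v)) → InCl M (edgesAvoiding ends v) e → Bound
    bound-if-spanned connected e∈cl = bound-with spans
      where
      module _ {S : Subset m} {y : Fin n} (v∉S : v ∉ S) (y∈S : y ∈ within S) where
        open Closure (hull-avoiding-v v∉S) using (inside-W; ⊇-start) renaming (hull to K; closed to K-closed)
        open Component v using (H; H-closed; grow)
        v∉K : v ∉ K
        v∉K v∈ = x∈∁p⇒x∉p (inside-W v∈) (x∈⁅x⁆ v)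
        X : Subset n
        X = within (∁ K)
        open Closure (closure Full {Full} {∁ K} ⊆⊤) using ()
          renaming (hull to L; grow to L-grow; closed to L-closed; ⊇-start to ∁K⊆L)
        y∈K : y ∈ within K
        y∈K = within-mono ⊇-start y∈S
        y∉X : y ∉ X
        y∉X y∈ = x∈∁p⇒x∉p (proj₁ (∈-within⁻ (∁ K) y∈)) (proj₁ (∈-within⁻ K y∈K))

        H⊆L : H ⊆ L
        H⊆L = grow-⊆ grow (⁅⁆-⊆ (∁K⊆L (x∉p⇒x∈∁p v∉K))) (λ f∈ j u∈ _ → L-closed f∈ j u∈ ∈⊤)

        -- Otherwise no edge would leave the complement of `K`, which would contain the whole
        -- component of `v` and hence `y`.
        leaving : ∃[ f ] (f ∉ X × f ∉ within K)
        leaving = decidable-stable (Fin.any? (λ f → ¬? (f ∈? X) ×-dec ¬? (f ∈? within K))) (λ none →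
          x∈∁p⇒x∉p
            (grow-⊆ {T = ∁ K} grow (⁅⁆-⊆ (x∉p⇒x∈∁p v∉K)) (λ {f} _ j u∈ _ → x∉p⇒x∈∁p (λ w∈ →
              none (f , (λ f∈X → x∈∁p⇒x∉p (proj₂ (joins-within⁻ (∁ K) j f∈X)) w∈) ,
                    (λ f∈K → x∈∁p⇒x∉p u∈ (proj₁ (joins-within⁻ K j f∈K))))))
              (connected y))
            (proj₁ (∈-within⁻ K y∈K)))

        D : Subset m
        D = L ∩ K

        -- Every edge here meets `K`, and in G - v none leaves it; only `v` can be an end outside
        -- `K`.
        ends-∁X : ∁ X ⊆ within (D ∪ ⁅ v ⁆)
        ends-∁X {f} f∈ = by-ends (src f ∈? K) (tgt f ∈? K)
          where
          s∈H : src f ∈ H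
          s∈H = connected f
          t∈H : tgt f ∈ H
          t∈H = H-closed ∈⊤ (joins-ends f) s∈H
          inD : ∀ {u} → u ∈ H → u ∈ K → u ∈ D ∪ ⁅ v ⁆
          inD u∈H u∈K = ∈-insertˡ (x∈p∩q⁺ (H⊆L u∈H , u∈K))
          next : ∀ {u w} → Joins ends f u w → u ∈ K → w ∉ K → w ∈ D ∪ ⁅ v ⁆
          next {w = w} j u∈ w∉ with w ∈? ⁅ v ⁆
          ... | yes w∈v = q⊆p∪q D _ w∈v
          ... | no w∉v = ⊥-elim (w∉ (K-closed ∈⊤ j u∈ (x∉p⇒x∈∁p w∉v)))
          by-ends : Dec (src f ∈ K) → Dec (tgt f ∈ K) → f ∈ within (D ∪ ⁅ v ⁆)
          by-ends (yes s) (yes t) = ∈-within⁺ (D ∪ ⁅ v ⁆) (inD s∈H s) (inD t∈H t)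
          by-ends (yes s) (no t) = ∈-within⁺ (D ∪ ⁅ v ⁆) (inD s∈H s) (next (joins-ends f) s t)
          by-ends (no s) (yes t) = ∈-within⁺ (D ∪ ⁅ v ⁆) (next (joins-sym (joins-ends f)) t s) (inD t∈H t)
          by-ends (no s) (no t) = ⊥-elim (x∈∁p⇒x∉p f∈ (∈-within⁺ (∁ K) (x∉p⇒x∈∁p s) (x∉p⇒x∈∁p t)))

        -- The edges outside `X` have rank at most |D| + 1, and growing the complement of `K`
        -- through `D` adds |D| to the rank of `X`.
        connectivity : r X + r (∁ X) ≤ suc (r Full)
        connectivity = +-cancelʳ-≤ ∣ ∁ K ∣ _ _ (begin
          (r X + r (∁ X)) + ∣ ∁ K ∣
            ≤⟨ +-monoˡ-≤ ∣ ∁ K ∣ (+-monoʳ-≤ (r X)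
                 (≤-trans (rank-mono ends-∁X) (≤-trans (rank-within _) (insert-card-≤ D v)))) ⟩
          (r X + suc ∣ D ∣) + ∣ ∁ K ∣            ≡⟨ rearrange (r X) (∣ D ∣) (∣ ∁ K ∣) ⟩
          suc (r X + (∣ D ∣ + ∣ ∁ K ∣))
            ≤⟨ s≤s (+-monoʳ-≤ (r X) (disjoint-card (p∩q⊆p L K) ∁K⊆L
                 (λ x∈ x∈∁ → x∈∁p⇒x∉p x∈∁ (p∩q⊆q L K x∈)))) ⟩
          suc (r X + ∣ L ∣)
            ≤⟨ s≤s (grow-rank L-grow (λ f∈ inc _ → within-incident (∁ K) f∈ inc) ⊆⊤ (λ _ _ → ∈⊤)) ⟩
          suc (r Full) + ∣ ∁ K ∣                 ∎)
          where
          open ≤-Reasoning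
          rearrange : ∀ a b c → (a + suc b) + c ≡ suc (a + (b + c))
          rearrange = solve-∀

        -- A 2-separation needs two elements on each side: `e` and `g` lie in `X`, while `y` and the
        -- edge from `leaving` do not.
        avoiding⊆K : edgesAvoiding ends v ⊆ within K
        avoiding⊆K {g} g∈ = decidable-stable (g ∈? within K) (λ g∉K →
          let (f , f∉X , f∉K) = leaving in
          no-2-separation
            (two-card e∈X (g∈X g∉K) (λ { refl → ∈-avoiding⁻ v g∈ (inj₁ refl) }))
            (two-card (x∉p⇒x∈∁p y∉X) (x∉p⇒x∈∁p f∉X) (λ y≡f → f∉K (subst (_∈ within K) y≡f y∈K)))
            connectivity)
          where
          e∈X : e ∈ X
          e∈X = ∈-within⁺ (∁ K) (x∉p⇒x∈∁p v∉K) (x∉p⇒x∈∁p (λ t∈ → v∉K (subst (_∈ K) (sym e-loop) t∈)))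
          away-from-v : ∀ {u} → Incident ends g u → u ∈ ∁ ⁅ v ⁆
          away-from-v inc = x∉p⇒x∈∁p (λ u∈v → ∈-avoiding⁻ v g∈ (subst (Incident ends g) (x∈⁅y⁆⇒x≡y v u∈v) inc))
          g∈X : g ∉ within K → g ∈ X
          g∈X g∉K = ∈-within⁺ (∁ K)
            (x∉p⇒x∈∁p (λ s → g∉K (∈-within⁺ K s (K-closed ∈⊤ (joins-ends g) s (away-from-v (inj₂ refl))))))
            (x∉p⇒x∈∁p (λ t → g∉K (∈-within⁺ K (K-closed ∈⊤ (joins-sym (joins-ends g)) t (away-from-v (inj₁ refl))) t)))

        spans : InCl M (within K) e
        spans = InCl-mono avoiding⊆K e∈cl

    -- A loop-edge alone in its component.

    module Lonely (lonely : ∀ {f} → f ≢ e → ¬ Incident ends f v) {f₀ : Fin n} (f₀≢e : f₀ ≢ e) where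

      e-indep : Indep M ⁅ e ⁆
      e-indep = decidable-stable (Indep? M ⁅ e ⁆) (λ dep → f₀≢e (dependent-only dep))

      v-closed : Closed Full ⁅ v ⁆
      v-closed {f} _ j u∈ with x∈⁅y⁆⇒x≡y v u∈ | f ≟ᶠ e
      ... | refl | no f≢e = ⊥-elim (lonely f≢e (joins-incident j))
      ... | refl | yes refl = subst (_∈ ⁅ v ⁆) (sym (incident-loop (joins-incident (joins-sym j)))) (x∈⁅x⁆ v)

      -- The other elements span `e`, so a basis of them together with `e` contains a circuit. It
      -- uses `e`, and another element because `e` is independent.
      circuit-through : ∃[ C ] (Circuit M C × e ∈ C × ∃[ f ] (f ∈ C × f ≢ e))
      circuit-through with basis (∁ ⁅ e ⁆)
      ... | I , I⊆ , indI , eqI with circuit-in {I ∪ ⁅ e ⁆} (λ ind → <⇒≱ (begin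
              suc (r (∁ ⁅ e ⁆))          ≡⟨ cong suc eqI ⟨
              suc ∣ I ∣                  ≡⟨ insert-card I (λ e∈ → x∈∁p⇒x∉p (I⊆ e∈) (x∈⁅x⁆ e)) ⟨
              ∣ I ∪ ⁅ e ⁆ ∣              ≤⟨ indep⇒≤rank (insert-mono I⊆) ind ⟩
              r (∁ ⁅ e ⁆ ∪ ⁅ e ⁆)        ∎) (≤-reflexive (spanned-by-rest f₀≢e)))
        where open ≤-Reasoning
      ... | C , C⊆ , circ = C , circ ,
              decidable-stable (e ∈? C) (λ e∉C → proj₁ circ (indep-⊆ M
                (λ f∈ → [ id , (λ { refl → ⊥-elim (e∉C f∈) }) ]′ (∈-insert⁻ I (C⊆ f∈))) indI)) ,
              decidable-stable (Fin.any? (λ f → (f ∈? C) ×-dec ¬? (f ≟ᶠ e))) (λ none →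
                proj₁ circ (indep-⊆ M {⁅ e ⁆} (λ {f} f∈ → subst (_∈ ⁅ e ⁆)
                  (sym (decidable-stable (f ≟ᶠ e) (λ f≢e → none (f , f∈ , f≢e)))) (x∈⁅x⁆ e)) e-indep))

      module Through {C : Subset n} {f : Fin n} (circ : Circuit M C) (e∈C : e ∈ C)
                     (f∈C : f ∈ C) (f≢e : f ≢ e) where

        spanned-by-circuit : InCl M (C - e) e
        spanned-by-circuit = ≤-antisym (begin
          r ((C - e) ∪ ⁅ e ⁆)        ≤⟨ rank-mono (insert-⊆ (p─q⊆p C ⁅ e ⁆) e∈C) ⟩
          r C                        ≤⟨ ≤-pred (≤-trans (≰⇒> (proj₁ circ ∘ rank⇒indep)) (≤-reflexive (remove-card e∈C))) ⟩
          ∣ C - e ∣                  ≡⟨ indep⇒rank (proj₂ circ e e∈C) ⟨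
          r (C - e)                  ∎) (rank-mono (p⊆p∪q ⁅ e ⁆))
          where open ≤-Reasoning

        open Component (src f)

        v∉H : v ∉ H
        v∉H v∈ = x∈∁p⇒x∉p (grow-⊆ {T = ∁ ⁅ v ⁆} grow
          (⁅⁆-⊆ (x∉p⇒x∈∁p (λ s∈ → lonely f≢e (inj₁ (x∈⁅y⁆⇒x≡y v s∈)))))
          (λ g∈ j u∈ _ → closed-∁ {S = ⁅ v ⁆} v-closed g∈ j u∈) v∈) (x∈⁅x⁆ v)

        -- In G[C] the loop-edge is a component of its own, so condition (4) leaves one component
        -- for the rest of `C`.
        C-e⊆H : C - e ⊆ within H
        C-e⊆H {g} g∈ = ∈-within⁺ H (reach (inj₁ refl)) (reach (inj₂ refl))
          where
          g∈C : g ∈ C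
          g∈C = p─q⊆p C ⁅ e ⁆ g∈
          g≢e : g ≢ e
          g≢e refl = proj₂ (∈-─⁻ C ⁅ e ⁆ g∈) (x∈⁅x⁆ e)
          stuck : ∀ {h u} → h ≢ e → Incident ends h u → ¬ Conn ends C v u
          stuck h≢e inc c = lonely h≢e (subst (Incident ends _)
            (x∈⁅y⁆⇒x≡y v (conn-closed {S = ⁅ v ⁆} (λ _ → v-closed ∈⊤) c (x∈⁅x⁆ v))) inc)
          reach : ∀ {u} → Incident ends g u → u ∈ H
          reach {u} inc with IsFramework.cond4 F C circ v (src f) u (e , e∈C , inj₁ refl)
                               (f , f∈C , inj₁ refl) (g , g∈C , inc)
          ... | inj₁ c = ⊥-elim (stuck f≢e (inj₁ refl) c)
          ... | inj₂ (inj₁ c) = ⊥-elim (stuck g≢e inc c)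
          ... | inj₂ (inj₂ c) = conn-closed {S = H} (λ _ → H-closed ∈⊤) c a∈H

        H-spans : InCl M (within H) e
        H-spans = InCl-mono C-e⊆H spanned-by-circuit

        f∈H : f ∈ within H
        f∈H = incident⇒within (inj₁ refl) a∈H

        e∉H : e ∉ within H
        e∉H e∈ = v∉H (proj₁ (∈-within⁻ H e∈))

        -- An edge within `S` lies in `H`, and avoiding the isolated vertex `v` costs nothing. So
        -- the hull of `S` contains `H`, which spans `e`.
        bound-if-exhausting : (∀ {g} → g ≢ e → g ∈ within H) → Bound
        bound-if-exhausting rest = bound-with (λ v∉S y∈ → InCl-mono (within-mono (H⊆hull v∉S y∈)) H-spans)
          where
          H⊆hull : ∀ {S y} (v∉S : v ∉ S) → y ∈ within S → H ⊆ Closure.hull (hull-avoiding-v v∉S)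
          H⊆hull {S} {y} v∉S y∈ h∈ = conn-closed {S = hull} hull-closed
            (conn-trans (conn-sym (grow-conn-⁅⁆ grow (proj₁ (∈-within⁻ H (rest y≢e))))) (grow-conn-⁅⁆ grow h∈))
            (⊇-start′ (proj₁ (∈-within⁻ S y∈)))
            where
            open Closure (hull-avoiding-v v∉S) using (hull)
              renaming (inside-W to avoiding; closed to closed′; ⊇-start to ⊇-start′)
            y≢e : y ≢ e
            y≢e refl = v∉S (proj₁ (∈-within⁻ S y∈))
            hull-closed : Closed Full hull
            hull-closed g∈ j u∈ = closed′ g∈ j u∈ (closed-∁ {S = ⁅ v ⁆} v-closed g∈ j (avoiding u∈))

        -- With `e` and `g` outside, the component has only one edge. Adding the spanned `e` gives a
        -- set `X` of rank at most 1, so at most one element is left over, and excluding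
        -- 1-separations brings the rank of `M` down to 1.
        bound-if-rank-one : ∀ {g} → g ≢ e → g ∉ within H → Bound
        bound-if-rank-one {g} g≢e g∉ (u , u∈) =
          ≤-trans (rank-mono ⊆⊤) (≤-trans rank-one (nonempty-card u∈))
          where
          X = within H ∪ ⁅ e ⁆
          e∈X = ∈-insertʳ (within H) e
          small : ∣ within H ∣ ≤ 1
          small = ≤-pred (≰⇒> (λ 2≤ → no-2-separation 2≤
            (two-card (x∉p⇒x∈∁p g∉) (x∉p⇒x∈∁p e∉H) g≢e) separation))
          rX≤1 : r X ≤ 1
          rX≤1 = ≤-trans (≤-reflexive H-spans) (≤-trans (rank≤card _) small)
          small′ : ∣ ∁ X ∣ ≤ 1
          small′ = ≤-pred (≰⇒> (λ 2≤ → no-2-separation (two-card (∈-insertˡ f∈H) e∈X f≢e) 2≤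
            (+-mono-≤ rX≤1 (rank-mono ⊆⊤))))
          rank-one : r Full ≤ 1
          rank-one = ≤-pred (≤-trans
            (≰⇒> (no-1-separation e∈X (λ g∈ → [ g∉ , g≢e ]′ (∈-insert⁻ (within H) g∈))))
            (+-mono-≤ rX≤1 (≤-trans (rank≤card (∁ X)) small′)))

      bound : Bound
      bound = by-circuit circuit-through
        where
        by-component : ∀ {C f} → Circuit M C → e ∈ C → f ∈ C → f ≢ e →
                       Dec (∃[ g ] (g ≢ e × g ∉ within (Component.H (src f)))) → Bound
        by-component circ e∈C f∈C f≢e (yes (g , g≢e , g∉)) =
          Through.bound-if-rank-one circ e∈C f∈C f≢e g≢e g∉
        by-component circ e∈C f∈C f≢e (no none) =
          Through.bound-if-exhausting circ e∈C f∈C f≢e (λ {g} g≢e →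
            decidable-stable (g ∈? _) (λ g∉ → none (g , g≢e , g∉)))
        by-circuit : ∃[ C ] (Circuit M C × e ∈ C × ∃[ f ] (f ∈ C × f ≢ e)) → Bound
        by-circuit (C , circ , e∈C , f , f∈C , f≢e) = by-component circ e∈C f∈C f≢e
          (Fin.any? (λ g → ¬? (g ≟ᶠ e) ×-dec ¬? (g ∈? within (Component.H (src f)))))

      lifted : IsLiftedGraphic M
      lifted = Lift.lifted-graphic M ends F e e-loop e-indep bound

  -- Edges outside the component of the loop-edge, and the conclusion.

  lifted-if-disconnected : ∀ {e g} → src e ≡ tgt e → g ∉ within (Component.H (src e)) → IsLiftedGraphic M
  lifted-if-disconnected {e} {g} e-loop g∉ = by-cases (2 ≤? ∣ X ∣) (2 ≤? ∣ ∁ X ∣) (src g ≟ᶠ tgt g)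
    where
    open ≤-Reasoning
    open Component (src e)
    X : Subset n
    X = within H
    e∈X : e ∈ X
    e∈X = incident⇒within (inj₁ refl) a∈H
    g≢e : g ≢ e
    g≢e refl = g∉ e∈X
    X-isolated : ∀ {f h u} → f ∈ X → Incident ends f u → Incident ends h u → h ∈ X
    X-isolated f∈ inc inc′ = incident⇒within inc′ (within-incident H f∈ inc)
    -- By `separation`, one side has a single edge. If that is `e`, or a loop-edge `g`, it is alone
    -- in its component; if it is a link `g`, it raises the rank and gives a 1-separation.
    by-cases : Dec (2 ≤ ∣ X ∣) → Dec (2 ≤ ∣ ∁ X ∣) → Dec (src g ≡ tgt g) → IsLiftedGraphic M
    by-cases (yes 2≤) (yes 2≤′) _ = ⊥-elim (no-2-separation 2≤ 2≤′ separation)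
    by-cases (no ¬2≤) _ _ = AtLoop.Lonely.lifted e e-loop
      (λ f≢e inc → ¬2≤ (two-card (incident⇒within inc a∈H) e∈X f≢e)) g≢e
    by-cases (yes _) (no ¬2≤) (yes g-loop) = AtLoop.Lonely.lifted g g-loop
      (λ f≢g inc → ¬2≤ (two-card (x∉p⇒x∈∁p (λ f∈ → g∉ (X-isolated f∈ inc (inj₁ refl)))) (x∉p⇒x∈∁p g∉) f≢g))
      (g≢e ∘ sym)
    by-cases (yes _) (no ¬2≤) (no s≢t) = ⊥-elim (no-1-separation e∈X g∉ (begin
      r X + r (∁ X)        ≤⟨ +-monoʳ-≤ (r X) (≤-trans (rank≤card (∁ X)) (≤-pred (≰⇒> ¬2≤))) ⟩
      r X + 1              ≡⟨ +-comm (r X) 1 ⟩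
      suc (r X)            ≤⟨ link-rank g (joins-ends g) s≢t (λ f∈ inc → g∉ (X-isolated f∈ inc (inj₂ refl))) ⟩
      r (X ∪ ⁅ g ⁆)        ≤⟨ rank-mono ⊆⊤ ⟩
      r Full               ∎))

  -- By `dependent-only` the matroid is a single element of rank 0, which the empty basis frames.
  frame-if-dependent : ∀ {e} → ¬ Indep M ⁅ e ⁆ → IsFrame M
  frame-if-dependent {e} dep = 0 , M ,
    (indep-∅ M , λ x _ ind → dep (indep-⊆ M (⁅⁆-⊆ (subst (_∈ ∅ ∪ ⁅ x ⁆) (dependent-only dep) (∈-insertʳ ∅ x))) ind)) ,
    (λ x → [] , z≤n , ≤-antisym (rank-≤ (λ {I} I⊆ ind → ≤-trans (≤-reflexive (∅-card (λ {y} y∈ →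
      dep (indep-⊆ M (⁅⁆-⊆ (subst (_∈ I) (dependent-only dep) y∈)) ind)))) z≤n)) (rank-mono (p⊆p∪q ⁅ x ⁆))) ,
    λ X → id , id

theorem1p5 : ∀ {n m : ℕ} (M : Matroid n) (ends : Ends n m) →
    ThreeConnected M → IsFramework M ends → HasLoop ends →
    IsFrame M ⊎ IsLiftedGraphic M
theorem1p5 M ends conn3 F (e , e-loop) =
  by-cases (Indep? M ⁅ e ⁆) (Fin.any? (λ g → ¬? (g ∈? within H))) (_ ≟ _)
  where
  open Graph ends
  open Separations M ends F conn3
  open Component (src e) using (H)
  connected : ¬ (∃[ g ] (g ∉ within H)) → ∀ f → src f ∈ H
  connected none f = proj₁ (∈-within⁻ H (decidable-stable (f ∈? within H) (λ f∉ → none (f , f∉))))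
  by-cases : Dec (Indep M ⁅ e ⁆) → Dec (∃[ g ] (g ∉ within H)) →
             Dec (InCl M (edgesAvoiding ends (src e)) e) → IsFrame M ⊎ IsLiftedGraphic M
  -- A dependent `e` is settled first because `Lift` contracts an element parallel to `e` and needs
  -- it to have rank 1.
  by-cases (no dep)  _              _          = inj₁ (frame-if-dependent dep)
  by-cases (yes _)   (yes (g , g∉)) _          = inj₂ (lifted-if-disconnected e-loop g∉)
  by-cases (yes ind) (no none)      (yes e∈cl) = inj₂ (Lift.lifted-graphic M ends F e e-loop ind
    (AtLoop.bound-if-spanned e e-loop (connected none) e∈cl))
  by-cases (yes ind) (no none)      (no e∉cl)  = inj₁ (Frame.frame M ends F
    (AtLoop.NotSpanned.direct e e-loop e∉cl (connected none)))
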